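{- Let $G$ be a simple graph with subgraphs $G_1$ and $G_2$ such that $G = G_1 \cup G_2$ and $G_1 \cap G_2$ consists of a single edge $e$ of $G$ together with its two end vertices. If $\theta(G_1) = n_1$ and $\theta(G_2) = n_2$, then $\max\{n_1, n_2\} \le \theta(G) \le n_1 + n_2 - 1$.
   Context: All graphs are simple. A planar decomposition of a graph $G$ is a collection of spanning subgraphs $G_1,\dots,G_k$ of $G$, each planar, whose edge sets are pairwise disjoint and have union $E(G)$. The thickness $\theta(G)$ is the minimum number $k$ of planar spanning subgraphs into which $G$ can be decomposed in this way. The union $G_1\cup G_2$ has vertex set $V(G_1)\cup V(G_2)$ and edge set $E(G_1)\cup E(G_2)$; the intersection is defined analogously. Such a $G$ is called the edge-amalgamation of $G_1$ and $G_2$ on $e$. -}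

module Defs where

open import Data.Bool using (Bool; true; false; _∧_; _∨_)
open import Data.Fin using (Fin)
open import Data.Nat using (ℕ)
open import Data.List using (List; []; _∷_)
open import Data.Product using (Σ; _×_; _,_; ∃)
open import Data.Sum using (_⊎_)
open import Data.Rational using (ℚ; 0ℚ; 1ℚ; _+_; _*_; _-_; _≤_)
open import Relation.Binary.PropositionalEquality using (_≡_)
open import Relation.Nullary using (¬_)
open import Function.Bundles using (_⇔_)

record Graph (N : ℕ) : Set where
  field
    VS     : Fin N → Bool
    Adj    : Fin N → Fin N → Bool
    sym    : ∀ u v → Adj u v ≡ Adj v u
    irrefl : ∀ u → Adj u u ≡ false
    adj-vs : ∀ u v → Adj u v ≡ true → VS u ≡ true
open Graph public

IsUnion : ∀ {N} → Graph N → Graph N → Graph N → Set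
IsUnion G G₁ G₂ =
  (∀ x → VS G x ≡ (VS G₁ x ∨ VS G₂ x)) ×
  (∀ x y → Adj G x y ≡ (Adj G₁ x y ∨ Adj G₂ x y))

IntersectionIsEdge : ∀ {N} → Graph N → Graph N → Fin N → Fin N → Set
IntersectionIsEdge G₁ G₂ u v =
  (∀ x → ((VS G₁ x ∧ VS G₂ x) ≡ true) ⇔ (x ≡ u ⊎ x ≡ v)) ×
  (∀ x y → ((Adj G₁ x y ∧ Adj G₂ x y) ≡ true) ⇔ ((x ≡ u × y ≡ v) ⊎ (x ≡ v × y ≡ u)))

-- Planarity, via piecewise-linear drawings in the rational plane ℚ².

Point : Set
Point = ℚ × ℚ

OnSeg : Point → Point → Point → Set
OnSeg (p₁ , p₂) (q₁ , q₂) x =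
  Σ ℚ λ t → (0ℚ ≤ t) × (t ≤ 1ℚ) ×
    (x ≡ (p₁ + t * (q₁ - p₁) , p₂ + t * (q₂ - p₂)))

OnPath : Point → List Point → Point → Point → Set
OnPath a []       b x = OnSeg a b x
OnPath a (c ∷ cs) b x = OnSeg a c x ⊎ OnPath c cs b x

SameEdge : ∀ {N} → Fin N → Fin N → Fin N → Fin N → Set
SameEdge u v x y = (u ≡ x × v ≡ y) ⊎ (u ≡ y × v ≡ x)

record PlaneDrawing {N : ℕ} (G : Graph N) : Set where
  field
    pos     : Fin N → Point
    bends   : Fin N → Fin N → List Point
    pos-inj : ∀ x y → VS G x ≡ true → VS G y ≡ true → pos x ≡ pos y → x ≡ y
    avoid   : ∀ u v w → Adj G u v ≡ true → VS G w ≡ true →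
              OnPath (pos u) (bends u v) (pos v) (pos w) → (w ≡ u ⊎ w ≡ v)
    cross   : ∀ u v x y p → Adj G u v ≡ true → Adj G x y ≡ true →
              ¬ SameEdge u v x y →
              OnPath (pos u) (bends u v) (pos v) p →
              OnPath (pos x) (bends x y) (pos y) p →
              ∃ λ w → (w ≡ u ⊎ w ≡ v) × (w ≡ x ⊎ w ≡ y) × (p ≡ pos w)

Planar : ∀ {N} → Graph N → Set
Planar G = PlaneDrawing G

record PlanarDecomposition {N : ℕ} (G : Graph N) (k : ℕ) : Set where
  field
    part      : Fin k → Graph N
    spanning  : ∀ i x → VS (part i) x ≡ VS G x
    planar    : ∀ i → Planar (part i)
    disjoint  : ∀ i j x y → Adj (part i) x y ≡ true → Adj (part j) x y ≡ true → i ≡ j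
    covers    : ∀ x y → (Adj G x y ≡ true) ⇔ (∃ λ i → Adj (part i) x y ≡ true)

IsThickness : ∀ {N} → Graph N → ℕ → Set
IsThickness G t =
  PlanarDecomposition G t × (∀ k → PlanarDecomposition G k → t Data.Nat.≤ k)

{-# OPTIONS --safe #-}

-- Restricting a decomposition of G to G₁ and G₂ gives the lower bound. For the upper bound, the parts of
-- G₁ and G₂ that contain e are amalgamated along e into one planar graph, and the remaining parts are
-- kept, with the missing vertices added far away.
--
-- The amalgamation is done on the drawings. First the polygonal curve representing e is straightened. If
-- it has the fewest possible bends, its first segment has a thin quadrilateral neighbourhood meeting the
-- other edges only at u and the rest of the curve only at the far end, and u can be dragged along it,
-- which saves a bend. Once e is a segment, rescaling makes the unit ℓ¹-ball, with u and v at (∓1, 0), free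
-- of everything else. The map p ↦ p / (2‖p‖ − 1), projective on each quadrant, then turns the second
-- drawing into the ball left free by the first. The fewest bends are only attained up to double negation,
-- which is harmless since t ≤ n₁ + n₂ − 1 is decidable.

module Submission where

open import Defs renaming (sym to Adj-sym)
open import Data.Bool using (Bool; true; false; _∧_; _∨_; not)
open import Data.Bool.Properties using (∨-comm; ∧-identityʳ; ∨-identityʳ; ∨-zeroʳ)
open import Data.Empty using (⊥; ⊥-elim)
open import Data.Fin using (Fin; zero; suc; toℕ; splitAt; join; punchIn; punchOut)
import Data.Fin.Properties as Fin
open import Data.Product using (Σ; ∃; _×_; _,_; proj₁; proj₂)
open import Data.Sum using (_⊎_; inj₁; inj₂; [_,_]′; swap) renaming (map to ⊎-map)
open import Function using (_∘_; id)
open import Function.Bundles using (mk⇔; Equivalence)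
open import Relation.Binary.PropositionalEquality using (_≡_; _≢_; refl; sym; trans; cong; cong₂; subst; subst₂)
open import Relation.Nullary using (¬_; yes; no; Dec; does)

-- The usual argument would put e on the outer face of both drawings. Here no face is ever
-- mentioned: a full neighbourhood of e is cleared instead, which needs only explicit estimates on
-- finitely many segments. Two features of `PlaneDrawing` shape this. An edge curve may cross or
-- retrace itself, so the curve of e has no tubular neighbourhood at first; minimality repairs this
-- near the first segment, since any return to it would allow a curve with fewer bends. And
-- arbitrarily many other edges may leave u in any direction, so u cannot move alone: everything
-- near u is pushed along, by a map that has to be injective only off the quadrilateral, whose
-- inside is empty. Every map must keep rational coordinates and turn segments into polygonal paths.
-- This rules out Euclidean lengths and circle inversion, and leads to the ℓ¹-norm, to piecewise
-- affine maps, and to a radial map that is projective on quadrants. Both drawings are stripped of e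
-- before they are moved; a single copy of e is drawn afresh on the upper boundary of the ball,
-- between the two.

module Geometry where

  import Data.Bool as Bool
  open import Data.List using (List; []; _∷_; _++_; map; length)
  open import Data.List.Properties using (length-map)
  open import Data.Nat as ℕ using (ℕ; z≤n; s≤s)
  import Data.Nat.Properties as ℕₚ
  open import Data.Product.Properties using (≡-dec)
  open import Data.Rational hiding (pos)
  open import Data.Rational.Properties
  open import Data.Unit using (⊤; tt)
  open import Level using (0ℓ)
  open import Relation.Binary.Definitions using (tri<; tri≈; tri>; DecidableEquality)
  open import Relation.Nullary.Decidable using (dec⇒maybe; _×-dec_; _⊎-dec_; dec-true; dec-false)
  open import Tactic.RingSolver using (solve-∀)
  open import Tactic.RingSolver.Core.AlmostCommutativeRing using (AlmostCommutativeRing; fromCommutativeRing)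

  -- Arithmetic of the rationals

  ℚ-ring : AlmostCommutativeRing 0ℓ 0ℓ
  ℚ-ring = fromCommutativeRing +-*-commutativeRing (λ x → dec⇒maybe (0ℚ ≟ x))

  0≤-from-≤ : ∀ {p q} → p ≤ q → 0ℚ ≤ q - p
  0≤-from-≤ {p} {q} p≤q = subst (_≤ q - p) (+-inverseʳ p) (+-monoˡ-≤ (- p) p≤q)

  0<-from-< : ∀ {p q} → p < q → 0ℚ < q - p
  0<-from-< {p} {q} p<q = subst (_< q - p) (+-inverseʳ p) (+-monoˡ-< (- p) p<q)

  -- A linear-arithmetic certificate: q − p is exhibited as a nonnegative (positive) expression.
  ≤-by : ∀ {p q r} → 0ℚ ≤ r → q - p ≡ r → p ≤ q
  ≤-by {p} {q} {r} 0≤r eq =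
    subst₂ _≤_ (+-identityˡ p) (cancel q p) (+-monoˡ-≤ p (subst (0ℚ ≤_) (sym eq) 0≤r))
    where
    cancel : ∀ q p → q - p + p ≡ q
    cancel = solve-∀ ℚ-ring

  <-by : ∀ {p q r} → 0ℚ < r → q - p ≡ r → p < q
  <-by {p} {q} {r} 0<r eq =
    subst₂ _<_ (+-identityˡ p) (cancel q p) (+-monoˡ-< p (subst (0ℚ <_) (sym eq) 0<r))
    where
    cancel : ∀ q p → q - p + p ≡ q
    cancel = solve-∀ ℚ-ring

  0≤+ : ∀ {p q} → 0ℚ ≤ p → 0ℚ ≤ q → 0ℚ ≤ p + q
  0≤+ = +-mono-≤

  0<+≤ : ∀ {p q} → 0ℚ < p → 0ℚ ≤ q → 0ℚ < p + q
  0<+≤ = +-mono-<-≤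

  0≤* : ∀ {p q} → 0ℚ ≤ p → 0ℚ ≤ q → 0ℚ ≤ p * q
  0≤* {p} {q} 0≤p 0≤q =
    nonNegative⁻¹ (p * q) {{nonNeg*nonNeg⇒nonNeg p {{nonNegative 0≤p}} q {{nonNegative 0≤q}}}}

  0<* : ∀ {p q} → 0ℚ < p → 0ℚ < q → 0ℚ < p * q
  0<* {p} {q} 0<p 0<q = positive⁻¹ (p * q) {{pos*pos⇒pos p {{positive 0<p}} q {{positive 0<q}}}}

  0<1 : 0ℚ < 1ℚ
  0<1 = positive⁻¹ 1ℚ

  0≤1 : 0ℚ ≤ 1ℚ
  0≤1 = <⇒≤ 0<1

  <-absurd : ∀ {p q} → p < q → q ≤ p → ⊥
  <-absurd p<q q≤p = <-irrefl refl (<-≤-trans p<q q≤p)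

  ≡-by : ∀ {p q} → q - p ≡ 0ℚ → p ≡ q
  ≡-by {p} {q} eq = ≤-antisym (≤-by ≤-refl eq) (≤-by ≤-refl (trans (flip p q) (cong -_ eq)))
    where
    flip : ∀ p q → p - q ≡ - (q - p)
    flip = solve-∀ ℚ-ring

  invert : ∀ {p} → p ≢ 0ℚ → ∃ λ i → p * i ≡ 1ℚ
  invert {p} p≢0 = 1/_ p {{≢-nonZero p≢0}} , *-inverseʳ p {{≢-nonZero p≢0}}

  0<⇒≢0 : ∀ {p} → 0ℚ < p → p ≢ 0ℚ
  0<⇒≢0 0<p refl = <-irrefl refl 0<p

  *-cancelˡ-0 : ∀ {p q} → p ≢ 0ℚ → p * q ≡ 0ℚ → q ≡ 0ℚ
  *-cancelˡ-0 {p} {q} p≢0 pq≡0 with invert p≢0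
  ... | i , pi≡1 = trans (sym (*-identityˡ q)) (trans (cong (_* q) (sym pi≡1))
        (trans (rearrange p i q) (trans (cong (i *_) pq≡0) (*-zeroʳ i))))
    where
    rearrange : ∀ p i q → p * i * q ≡ i * (p * q)
    rearrange = solve-∀ ℚ-ring

  invert⁺ : ∀ {p} → 0ℚ < p → ∃ λ i → 0ℚ < i × p * i ≡ 1ℚ
  invert⁺ {p} 0<p with invert (0<⇒≢0 0<p)
  ... | i , pi≡1 with i ≤? 0ℚ
  ... | no i≰0 = i , ≰⇒> i≰0 , pi≡1
  ... | yes i≤0 = ⊥-elim (<-absurd 0<1 (≤-by (0≤* (<⇒≤ 0<p) (0≤-from-≤ i≤0))
        (trans (cong (λ z → 0ℚ - z) (sym pi≡1)) (neg-out p i))))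
    where
    neg-out : ∀ p i → 0ℚ - p * i ≡ p * (0ℚ - i)
    neg-out = solve-∀ ℚ-ring

  0≤-cancelˡ : ∀ {p q} → 0ℚ < p → 0ℚ ≤ p * q → 0ℚ ≤ q
  0≤-cancelˡ {p} {q} 0<p 0≤pq with invert⁺ 0<p
  ... | i , 0<i , pi≡1 = ≤-by (0≤* (<⇒≤ 0<i) 0≤pq) (trans (lhs q) (trans (cong (_* q) (sym pi≡1)) (rearrange p i q)))
    where
    lhs : ∀ q → q - 0ℚ ≡ 1ℚ * q
    lhs = solve-∀ ℚ-ring
    rearrange : ∀ p i q → p * i * q ≡ i * (p * q)
    rearrange = solve-∀ ℚ-ring

  0≤sq : ∀ p → 0ℚ ≤ p * p
  0≤sq p with ≤-total 0ℚ p
  ... | inj₁ 0≤p = 0≤* 0≤p 0≤p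
  ... | inj₂ p≤0 = ≤-by (0≤* (0≤-from-≤ p≤0) (0≤-from-≤ p≤0)) (lem p)
    where
    lem : ∀ p → p * p - 0ℚ ≡ (0ℚ - p) * (0ℚ - p)
    lem = solve-∀ ℚ-ring

  p≤∣p∣ : ∀ p → p ≤ ∣ p ∣
  p≤∣p∣ p with ≤-total 0ℚ p
  ... | inj₁ 0≤p = ≤-reflexive (sym (0≤p⇒∣p∣≡p 0≤p))
  ... | inj₂ p≤0 = ≤-trans p≤0 (0≤∣p∣ p)

  -p≤∣p∣ : ∀ p → - p ≤ ∣ p ∣
  -p≤∣p∣ p = subst (- p ≤_) (∣-p∣≡∣p∣ p) (p≤∣p∣ (- p))

  p≤0⇒∣p∣≡-p : ∀ {p} → p ≤ 0ℚ → ∣ p ∣ ≡ - p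
  p≤0⇒∣p∣≡-p {p} p≤0 = trans (sym (∣-p∣≡∣p∣ p)) (0≤p⇒∣p∣≡p (≤-by (0≤-from-≤ p≤0) (lem p)))
    where
    lem : ∀ p → - p - 0ℚ ≡ 0ℚ - p
    lem = solve-∀ ℚ-ring

  -- Uses up a hypothesis a ≡ b in a ring identity, which the solver proves with the correction term k (a − b).
  drop-eq : ∀ r k {a b} → a ≡ b → r + k * (a - b) ≡ r
  drop-eq r k {a} refl = lem r k a
    where
    lem : ∀ r k a → r + k * (a - a) ≡ r
    lem = solve-∀ ℚ-ring

  -- Segments and polygonal paths

  seg-start : ∀ a b → OnSeg a b a
  seg-start (a₁ , a₂) (b₁ , b₂) = 0ℚ , ≤-refl , 0≤1 , cong₂ _,_ (lem a₁ b₁) (lem a₂ b₂)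
    where
    lem : ∀ x y → x ≡ x + 0ℚ * (y - x)
    lem = solve-∀ ℚ-ring

  seg-end : ∀ a b → OnSeg a b b
  seg-end (a₁ , a₂) (b₁ , b₂) = 1ℚ , 0≤1 , ≤-refl , cong₂ _,_ (lem a₁ b₁) (lem a₂ b₂)
    where
    lem : ∀ x y → y ≡ x + 1ℚ * (y - x)
    lem = solve-∀ ℚ-ring

  seg-convex : ∀ a b {c d p} → OnSeg a b c → OnSeg a b d → OnSeg c d p → OnSeg a b p
  seg-convex (a₁ , a₂) (b₁ , b₂) (s , 0≤s , s≤1 , refl) (s′ , 0≤s′ , s′≤1 , refl) (t , 0≤t , t≤1 , refl) =
    s + t * (s′ - s) ,
    ≤-by (0≤+ (0≤* (0≤-from-≤ t≤1) 0≤s) (0≤* 0≤t 0≤s′)) (low s s′ t) ,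
    ≤-by (0≤+ (0≤* (0≤-from-≤ t≤1) (0≤-from-≤ s≤1)) (0≤* 0≤t (0≤-from-≤ s′≤1))) (high s s′ t) ,
    cong₂ _,_ (lem a₁ b₁ s s′ t) (lem a₂ b₂ s s′ t)
    where
    low : ∀ s s′ t → s + t * (s′ - s) - 0ℚ ≡ (1ℚ - t) * s + t * s′
    low = solve-∀ ℚ-ring
    high : ∀ s s′ t → 1ℚ - (s + t * (s′ - s)) ≡ (1ℚ - t) * (1ℚ - s) + t * (1ℚ - s′)
    high = solve-∀ ℚ-ring
    lem : ∀ x y s s′ t → x + s * (y - x) + t * (x + s′ * (y - x) - (x + s * (y - x))) ≡ x + (s + t * (s′ - s)) * (y - x)
    lem = solve-∀ ℚ-ring

  seg-prefix : ∀ a b {c p} → OnSeg a b c → OnSeg a c p → OnSeg a b p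
  seg-prefix a b c∈ = seg-convex a b (seg-start a b) c∈

  seg-suffix : ∀ a b {c p} → OnSeg a b c → OnSeg c b p → OnSeg a b p
  seg-suffix a b c∈ = seg-convex a b c∈ (seg-end a b)

  seg-rev : ∀ a b {p} → OnSeg a b p → OnSeg b a p
  seg-rev a b = seg-convex b a (seg-end b a) (seg-start b a)

  seg-point : ∀ {a p} → OnSeg a a p → p ≡ a
  seg-point {a₁ , a₂} (t , _ , _ , refl) = cong₂ _,_ (lem a₁ t) (lem a₂ t)
    where
    lem : ∀ x t → x + t * (x - x) ≡ x
    lem = solve-∀ ℚ-ring

  path-end : ∀ a cs b → OnPath a cs b b
  path-end a []       b = seg-end a b
  path-end a (c ∷ cs) b = inj₂ (path-end c cs b)

  path-++ : ∀ a cs c ds b {p} → OnPath a (cs ++ c ∷ ds) b p → OnPath a cs c p ⊎ OnPath c ds b p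
  path-++ a []        c ds b h        = h
  path-++ a (c′ ∷ cs) c ds b (inj₁ h) = inj₁ (inj₁ h)
  path-++ a (c′ ∷ cs) c ds b (inj₂ h) = ⊎-map inj₂ id (path-++ c′ cs c ds b h)

  path-from : ∀ a cs b {p} → OnPath a cs b p →
              ∃ λ ds → length ds ℕ.≤ length cs × (∀ q → OnPath p ds b q → OnPath a cs b q)
  path-from a []       b p∈ = [] , z≤n , λ q → seg-suffix a b p∈
  path-from a (c ∷ cs) b (inj₁ p∈) =
    c ∷ cs , ℕₚ.≤-refl , λ q → ⊎-map (seg-suffix a c p∈) id
  path-from a (c ∷ cs) b (inj₂ p∈) with path-from c cs b p∈
  ... | ds , ds≤ , sub = ds , ℕₚ.m≤n⇒m≤1+n ds≤ , λ q → inj₂ ∘ sub q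

  -- Linear forms and piecewise projective maps

  record Form : Set where
    constructor form
    field coeffˣ coeffʸ const : ℚ

  ⟦_⟧ : Form → Point → ℚ
  ⟦ form α β γ ⟧ (x , y) = α * x + β * y + γ

  form-on-seg : ∀ L a b t → ⟦ L ⟧ (proj₁ a + t * (proj₁ b - proj₁ a) , proj₂ a + t * (proj₂ b - proj₂ a))
                            ≡ ⟦ L ⟧ a + t * (⟦ L ⟧ b - ⟦ L ⟧ a)
  form-on-seg (form α β γ) (a₁ , a₂) (b₁ , b₂) t = lem α β γ a₁ a₂ b₁ b₂ t
    where
    lem : ∀ α β γ a₁ a₂ b₁ b₂ t → α * (a₁ + t * (b₁ - a₁)) + β * (a₂ + t * (b₂ - a₂)) + γ
          ≡ α * a₁ + β * a₂ + γ + t * (α * b₁ + β * b₂ + γ - (α * a₁ + β * a₂ + γ))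
    lem = solve-∀ ℚ-ring

  nonneg-on-seg : ∀ L {a b p} → 0ℚ ≤ ⟦ L ⟧ a → 0ℚ ≤ ⟦ L ⟧ b → OnSeg a b p → 0ℚ ≤ ⟦ L ⟧ p
  nonneg-on-seg L {a} {b} 0≤A 0≤B (t , 0≤t , t≤1 , refl) =
    subst (0ℚ ≤_) (sym (form-on-seg L a b t))
      (≤-by (0≤+ (0≤* (0≤-from-≤ t≤1) 0≤A) (0≤* 0≤t 0≤B)) (lem (⟦ L ⟧ a) (⟦ L ⟧ b) t))
    where
    lem : ∀ A B t → A + t * (B - A) - 0ℚ ≡ (1ℚ - t) * A + t * B
    lem = solve-∀ ℚ-ring

  nonpos-on-seg : ∀ L {a b p} → ⟦ L ⟧ a ≤ 0ℚ → ⟦ L ⟧ b ≤ 0ℚ → OnSeg a b p → ⟦ L ⟧ p ≤ 0ℚ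
  nonpos-on-seg L {a} {b} A≤0 B≤0 (t , 0≤t , t≤1 , refl) =
    subst (_≤ 0ℚ) (sym (form-on-seg L a b t))
      (≤-by (0≤+ (0≤* (0≤-from-≤ t≤1) (0≤-from-≤ A≤0)) (0≤* 0≤t (0≤-from-≤ B≤0))) (lem (⟦ L ⟧ a) (⟦ L ⟧ b) t))
    where
    lem : ∀ A B t → 0ℚ - (A + t * (B - A)) ≡ (1ℚ - t) * (0ℚ - A) + t * (0ℚ - B)
    lem = solve-∀ ℚ-ring

  ≤∧≢⇒< : ∀ {p q} → p ≤ q → p ≢ q → p < q
  ≤∧≢⇒< {p} {q} p≤q p≢q with q ≤? p
  ... | yes q≤p = ⊥-elim (p≢q (≤-antisym p≤q q≤p))
  ... | no q≰p  = ≰⇒> q≰p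

  zero-between : ∀ A B → A ≤ 0ℚ → 0ℚ ≤ B → ∃ λ t → 0ℚ ≤ t × t ≤ 1ℚ × A + t * (B - A) ≡ 0ℚ
  zero-between A B A≤0 0≤B with A ≟ 0ℚ
  ... | yes refl = 0ℚ , ≤-refl , 0≤1 , lem B
    where
    lem : ∀ B → 0ℚ + 0ℚ * (B - 0ℚ) ≡ 0ℚ
    lem = solve-∀ ℚ-ring
  ... | no A≢0 =
    let i , 0<i , inv = invert⁺ {B - A} (≤-<-trans 0≤B (<-by (0<-from-< (≤∧≢⇒< A≤0 A≢0)) (gap A B))) in
    -- The root is t = -A / (B - A), and B - A is positive because A < 0 ≤ B here.
    (0ℚ - A) * i , 0≤* (0≤-from-≤ A≤0) (<⇒≤ 0<i) ,
    ≤-by (0≤* 0≤B (<⇒≤ 0<i)) (trans (high A B i) (drop-eq (B * i) (- 1ℚ) inv)) ,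
    ≡-by (trans (mid A B i) (drop-eq 0ℚ A inv))
    where
    gap : ∀ A B → B - A - B ≡ 0ℚ - A
    gap = solve-∀ ℚ-ring
    high : ∀ A B i → 1ℚ - (0ℚ - A) * i ≡ B * i + - 1ℚ * ((B - A) * i - 1ℚ)
    high = solve-∀ ℚ-ring
    mid : ∀ A B i → 0ℚ - (A + (0ℚ - A) * i * (B - A)) ≡ 0ℚ + A * ((B - A) * i - 1ℚ)
    mid = solve-∀ ℚ-ring

  zero-on-seg : ∀ L a b → ⟦ L ⟧ a ≤ 0ℚ → 0ℚ ≤ ⟦ L ⟧ b → ∃ λ c → OnSeg a b c × ⟦ L ⟧ c ≡ 0ℚ
  zero-on-seg L a b A≤0 0≤B =
    let t , 0≤t , t≤1 , eq = zero-between (⟦ L ⟧ a) (⟦ L ⟧ b) A≤0 0≤B in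
    _ , (t , 0≤t , t≤1 , refl) , trans (form-on-seg L a b t) eq

  -- One inclusion is enough: the clauses of a drawing only forbid meetings, so they survive when a
  -- path is replaced by a path inside the image.
  PathImage : (Point → Point) → Point → Point → Set
  PathImage f a b = Σ (List Point) λ cs → ∀ p → OnPath (f a) cs (f b) p → ∃ λ q → OnSeg a b q × p ≡ f q

  -- `P` is imposed on the whole source segment because the maps in use have a good description only
  -- off a ball or a kite.
  Traces : (Point → Point) → (Point → Set) → Set
  Traces f P = ∀ a b → (∀ p → OnSeg a b p → P p) → PathImage f a b

  path-image-join : ∀ {f a c b} → OnSeg a b c → PathImage f a c → PathImage f c b → PathImage f a b
  path-image-join {f} {a} {c} {b} c∈ (cs , on-cs) (ds , on-ds) = cs ++ f c ∷ ds , λ p h →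
    [ (λ h → let (q , q∈ , eq) = on-cs p h in q , seg-prefix a b c∈ q∈ , eq)
    , (λ h → let (q , q∈ , eq) = on-ds p h in q , seg-suffix a b c∈ q∈ , eq)
    ]′ (path-++ (f a) cs (f c) ds (f b) h)

  -- A segment on which `L` changes sign is cut at a zero of `L`. The zero lies in both closed
  -- half-planes, so each piece falls under one hypothesis.
  traces-split : ∀ {f P} L → Traces f (λ p → P p × 0ℚ ≤ ⟦ L ⟧ p) → Traces f (λ p → P p × ⟦ L ⟧ p ≤ 0ℚ) → Traces f P
  traces-split {f} {P} L on-pos on-neg a b P-seg with ≤-total 0ℚ (⟦ L ⟧ a) | ≤-total 0ℚ (⟦ L ⟧ b)
  ... | inj₁ 0≤A | inj₁ 0≤B = on-pos a b λ p p∈ → P-seg p p∈ , nonneg-on-seg L 0≤A 0≤B p∈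
  ... | inj₂ A≤0 | inj₂ B≤0 = on-neg a b λ p p∈ → P-seg p p∈ , nonpos-on-seg L A≤0 B≤0 p∈
  ... | inj₂ A≤0 | inj₁ 0≤B =
    let c , c∈ , eq = zero-on-seg L a b A≤0 0≤B in path-image-join c∈
    (on-neg a c λ p p∈ → P-seg p (seg-prefix a b c∈ p∈) , nonpos-on-seg L A≤0 (≤-reflexive eq) p∈)
    (on-pos c b λ p p∈ → P-seg p (seg-suffix a b c∈ p∈) , nonneg-on-seg L (≤-reflexive (sym eq)) 0≤B p∈)
  ... | inj₁ 0≤A | inj₂ B≤0 =
    let c , c∈′ , eq = zero-on-seg L b a B≤0 0≤A
        c∈ = seg-rev b a c∈′ in path-image-join c∈
    (on-pos a c λ p p∈ → P-seg p (seg-prefix a b c∈ p∈) , nonneg-on-seg L 0≤A (≤-reflexive (sym eq)) p∈)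
    (on-neg c b λ p p∈ → P-seg p (seg-suffix a b c∈ p∈) , nonpos-on-seg L (≤-reflexive eq) B≤0 p∈)

  -- A projective transformation sends [a,b] onto [f a, f b], with the parameter t of the target
  -- corresponding to the parameter t L₀(a) / (t L₀(a) + (1 − t) L₀(b)) of the source.
  traces-projective : ∀ {f P} L₀ L₁ L₂ →
    (∀ p → P p → 0ℚ < ⟦ L₀ ⟧ p × ⟦ L₀ ⟧ p * proj₁ (f p) ≡ ⟦ L₁ ⟧ p × ⟦ L₀ ⟧ p * proj₂ (f p) ≡ ⟦ L₂ ⟧ p) →
    Traces f P
  traces-projective {f} {P} L₀ L₁ L₂ f-proj a b P-seg = [] , on-image
    where
    A = ⟦ L₀ ⟧ a
    B = ⟦ L₀ ⟧ b
    Pa = f-proj a (P-seg a (seg-start a b))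
    Pb = f-proj b (P-seg b (seg-end a b))

    -- At parameter s the map is the mean of `fa` and `fb` with weights (1 - s)A and sB; for s = tA
    -- / (tA + (1 - t)B) these are in the ratio (1 - t) : t.
    coord : ∀ L t s {i} (fa fb fq : ℚ) → (t * A + (1ℚ - t) * B) * i ≡ 1ℚ → s ≡ t * A * i →
            A * fa ≡ ⟦ L ⟧ a → B * fb ≡ ⟦ L ⟧ b →
            0ℚ < A + s * (B - A) → (A + s * (B - A)) * fq ≡ ⟦ L ⟧ a + s * (⟦ L ⟧ b - ⟦ L ⟧ a) →
            fa + t * (fb - fa) ≡ fq
    coord L t s {i} fa fb fq inv refl eqa eqb 0<D eqq = sym (≡-by
      (*-cancelˡ-0 (0<⇒≢0 0<D)
        (trans (lem A B fa fb fq t i (⟦ L ⟧ a) (⟦ L ⟧ b))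
        (trans (drop-eq _ (1ℚ - s) eqa)
        (trans (drop-eq _ s eqb)
        (trans (drop-eq _ (- 1ℚ) eqq)
               (drop-eq 0ℚ ((fa - fb) * (t * A)) inv)))))))
      where
      lem : ∀ A B fa fb fq t i La Lb → let s = t * A * i in
            (A + s * (B - A)) * (fa + t * (fb - fa) - fq) ≡
            0ℚ + (fa - fb) * (t * A) * ((t * A + (1ℚ - t) * B) * i - 1ℚ)
               + - 1ℚ * ((A + s * (B - A)) * fq - (La + s * (Lb - La)))
               + s * (B * fb - Lb)
               + (1ℚ - s) * (A * fa - La)
      lem = solve-∀ ℚ-ring

    on-image : ∀ p → OnSeg (f a) (f b) p → ∃ λ q → OnSeg a b q × p ≡ f q
    on-image p (t , 0≤t , t≤1 , refl) = q , q∈ , cong₂ _,_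
        (coord L₁ t s (proj₁ (f a)) (proj₁ (f b)) (proj₁ (f q)) inv refl (proj₁ (proj₂ Pa)) (proj₁ (proj₂ Pb)) 0<Q
          (trans (cong (_* proj₁ (f q)) (sym (form-on-seg L₀ a b s))) (trans (proj₁ (proj₂ Pq)) (form-on-seg L₁ a b s))))
        (coord L₂ t s (proj₂ (f a)) (proj₂ (f b)) (proj₂ (f q)) inv refl (proj₂ (proj₂ Pa)) (proj₂ (proj₂ Pb)) 0<Q
          (trans (cong (_* proj₂ (f q)) (sym (form-on-seg L₀ a b s))) (trans (proj₂ (proj₂ Pq)) (form-on-seg L₂ a b s))))
      where
      0<A = proj₁ Pa
      0<B = proj₁ Pb
      0<W : 0ℚ < t * A + (1ℚ - t) * B
      0<W with t ≤? 0ℚ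
      ... | no t≰0  = 0<+≤ (0<* (≰⇒> t≰0) 0<A) (0≤* (0≤-from-≤ t≤1) (<⇒≤ 0<B))
      ... | yes t≤0 = subst (0ℚ <_) (+-comm ((1ℚ - t) * B) (t * A))
                        (0<+≤ (0<* (0<-from-< (≤-<-trans t≤0 0<1)) 0<B) (0≤* 0≤t (<⇒≤ 0<A)))
      invW = invert⁺ 0<W
      i = proj₁ invW
      0<i = proj₁ (proj₂ invW)
      inv = proj₂ (proj₂ invW)
      s = t * A * i
      q : Point
      q = proj₁ a + s * (proj₁ b - proj₁ a) , proj₂ a + s * (proj₂ b - proj₂ a)
      s≤1 : s ≤ 1ℚ
      s≤1 = ≤-by (0≤* (0≤* (0≤-from-≤ t≤1) (<⇒≤ 0<B)) (<⇒≤ 0<i))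
                 (trans (lem A B t i) (drop-eq ((1ℚ - t) * B * i) (- 1ℚ) inv))
        where
        lem : ∀ A B t i → 1ℚ - t * A * i ≡ (1ℚ - t) * B * i + - 1ℚ * ((t * A + (1ℚ - t) * B) * i - 1ℚ)
        lem = solve-∀ ℚ-ring
      q∈ : OnSeg a b q
      q∈ = s , 0≤* (0≤* 0≤t (<⇒≤ 0<A)) (<⇒≤ 0<i) , s≤1 , refl
      Pq = f-proj q (P-seg q q∈)
      0<Q : 0ℚ < A + s * (B - A)
      0<Q = subst (0ℚ <_) (form-on-seg L₀ a b s) (proj₁ Pq)

  path-image : ∀ {f P} → Traces f P → ∀ a cs b → (∀ p → OnPath a cs b p → P p) →
               Σ (List Point) λ ds → ∀ p → OnPath (f a) ds (f b) p → ∃ λ q → OnPath a cs b q × p ≡ f q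
  path-image tr a []       b P-path = tr a b P-path
  path-image {f} tr a (c ∷ cs) b P-path =
    let ds , on-ds = tr a c (λ p → P-path p ∘ inj₁)
        es , on-es = path-image tr c cs b (λ p → P-path p ∘ inj₂)
    in ds ++ f c ∷ es , λ p h →
    [ (λ h → let (q , q∈ , eq) = on-ds p h in q , inj₁ q∈ , eq)
    , (λ h → let (q , q∈ , eq) = on-es p h in q , inj₂ q∈ , eq)
    ]′ (path-++ (f a) ds (f c) es (f b) h)

  2ℚ : ℚ
  2ℚ = 1ℚ + 1ℚ

  InjectiveOn : (Point → Set) → (Point → Point) → Set
  InjectiveOn P f = ∀ p q → P p → P q → f p ≡ f q → p ≡ q

  xForm yForm 1Form : Form
  xForm = form 1ℚ 0ℚ 0ℚ
  yForm = form 0ℚ 1ℚ 0ℚ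
  1Form = form 0ℚ 0ℚ 1ℚ

  xForm≡ : ∀ x y → ⟦ xForm ⟧ (x , y) ≡ x
  xForm≡ = lem
    where
    lem : ∀ x y → 1ℚ * x + 0ℚ * y + 0ℚ ≡ x
    lem = solve-∀ ℚ-ring

  yForm≡ : ∀ x y → ⟦ yForm ⟧ (x , y) ≡ y
  yForm≡ = lem
    where
    lem : ∀ x y → 0ℚ * x + 1ℚ * y + 0ℚ ≡ y
    lem = solve-∀ ℚ-ring

  1Form≡ : ∀ x y → ⟦ 1Form ⟧ (x , y) ≡ 1ℚ
  1Form≡ = lem
    where
    lem : ∀ x y → 0ℚ * x + 0ℚ * y + 1ℚ ≡ 1ℚ
    lem = solve-∀ ℚ-ring

  traces-affine : ∀ {f P} L M → (∀ p → P p → proj₁ (f p) ≡ ⟦ L ⟧ p × proj₂ (f p) ≡ ⟦ M ⟧ p) → Traces f P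
  traces-affine {f} L M f-aff = traces-projective 1Form L M λ p Pp →
    subst (0ℚ <_) (sym (1Form≡ (proj₁ p) (proj₂ p))) 0<1 ,
    trans (cong (_* proj₁ (f p)) (1Form≡ (proj₁ p) (proj₂ p))) (trans (*-identityˡ _) (proj₁ (f-aff p Pp))) ,
    trans (cong (_* proj₂ (f p)) (1Form≡ (proj₁ p) (proj₂ p))) (trans (*-identityˡ _) (proj₂ (f-aff p Pp)))

  traces-id : ∀ {f P} → (∀ p → P p → f p ≡ p) → Traces f P
  traces-id f-id = traces-affine xForm yForm λ p Pp →
    trans (cong proj₁ (f-id p Pp)) (sym (xForm≡ (proj₁ p) (proj₂ p))) ,
    trans (cong proj₂ (f-id p Pp)) (sym (yForm≡ (proj₁ p) (proj₂ p)))

  abs⁺ : ∀ {z} → 0ℚ ≤ z → ∣ z ∣ ≡ 1ℚ * z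
  abs⁺ {z} 0≤z = trans (0≤p⇒∣p∣≡p 0≤z) (sym (*-identityˡ z))

  abs⁻ : ∀ {z} → z ≤ 0ℚ → ∣ z ∣ ≡ - 1ℚ * z
  abs⁻ {z} z≤0 = trans (p≤0⇒∣p∣≡-p z≤0) (lem z)
    where
    lem : ∀ z → - z ≡ - 1ℚ * z
    lem = solve-∀ ℚ-ring

  -- On a closed quadrant |x| = σx and |y| = τy with constant signs, so whatever is built from
  -- absolute values becomes rational in x and y there.
  traces-quadrants : ∀ {f P} →
    (∀ σ τ → Traces f (λ p → P p × ∣ proj₁ p ∣ ≡ σ * proj₁ p × ∣ proj₂ p ∣ ≡ τ * proj₂ p)) → Traces f P
  traces-quadrants {f} {P} tr =
    traces-split xForm
      (traces-split yForm (on 1ℚ 1ℚ (λ (x , y) ((Pp , 0≤x) , 0≤y) → Pp , abs⁺ (nn x y 0≤x) , abs⁺ (nn′ x y 0≤y)))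
                          (on 1ℚ (- 1ℚ) (λ (x , y) ((Pp , 0≤x) , y≤0) → Pp , abs⁺ (nn x y 0≤x) , abs⁻ (np′ x y y≤0))))
      (traces-split yForm (on (- 1ℚ) 1ℚ (λ (x , y) ((Pp , x≤0) , 0≤y) → Pp , abs⁻ (np x y x≤0) , abs⁺ (nn′ x y 0≤y)))
                          (on (- 1ℚ) (- 1ℚ) (λ (x , y) ((Pp , x≤0) , y≤0) → Pp , abs⁻ (np x y x≤0) , abs⁻ (np′ x y y≤0))))
    where
    on : ∀ σ τ {Q : Point → Set} →
         (∀ p → Q p → P p × ∣ proj₁ p ∣ ≡ σ * proj₁ p × ∣ proj₂ p ∣ ≡ τ * proj₂ p) → Traces f Q
    on σ τ Q⇒ a b Q-seg = tr σ τ a b λ p p∈ → Q⇒ p (Q-seg p p∈)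
    nn : ∀ x y → 0ℚ ≤ ⟦ xForm ⟧ (x , y) → 0ℚ ≤ x
    nn x y = subst (0ℚ ≤_) (xForm≡ x y)
    np : ∀ x y → ⟦ xForm ⟧ (x , y) ≤ 0ℚ → x ≤ 0ℚ
    np x y = subst (_≤ 0ℚ) (xForm≡ x y)
    nn′ : ∀ x y → 0ℚ ≤ ⟦ yForm ⟧ (x , y) → 0ℚ ≤ y
    nn′ x y = subst (0ℚ ≤_) (yForm≡ x y)
    np′ : ∀ x y → ⟦ yForm ⟧ (x , y) ≤ 0ℚ → y ≤ 0ℚ
    np′ x y = subst (_≤ 0ℚ) (yForm≡ x y)

  -- Turning the exterior of the unit ℓ¹-ball inside out

  ‖_‖ : Point → ℚ
  ‖ x , y ‖ = ∣ x ∣ + ∣ y ∣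

  -- Made total so that `invertBall` is defined on the whole plane. The value at 0 is a mere
  -- default: where 1 ≤ ‖p‖ the denominator 2‖p‖ - 1 is positive.
  reciprocal : ℚ → ℚ
  reciprocal p with p ≟ 0ℚ
  ... | yes _   = 0ℚ
  ... | no p≢0 = proj₁ (invert p≢0)

  *-reciprocal : ∀ {p} → p ≢ 0ℚ → p * reciprocal p ≡ 1ℚ
  *-reciprocal {p} p≢0 with p ≟ 0ℚ
  ... | yes p≡0 = ⊥-elim (p≢0 p≡0)
  ... | no p≢0′ = proj₂ (invert p≢0′)

  scale : Point → ℚ
  scale p = reciprocal (2ℚ * ‖ p ‖ - 1ℚ)

  -- Along every ray from the origin this is r ↦ r / (2r − 1) in the ℓ¹-norm r: it fixes r = 1 and sends
  -- r = ∞ to r = 1/2. On each quadrant it is projective.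
  invertBall : Point → Point
  invertBall p = proj₁ p * scale p , proj₂ p * scale p

  module _ (p : Point) (1≤‖p‖ : 1ℚ ≤ ‖ p ‖) where

    denominator-pos : 0ℚ < 2ℚ * ‖ p ‖ - 1ℚ
    denominator-pos = <-by (0<+≤ 0<1 (0≤+ (0≤-from-≤ 1≤‖p‖) (0≤-from-≤ 1≤‖p‖))) (lem ‖ p ‖)
      where
      lem : ∀ n → 2ℚ * n - 1ℚ - 0ℚ ≡ 1ℚ + (n - 1ℚ + (n - 1ℚ))
      lem = solve-∀ ℚ-ring

    scale-inverse : (2ℚ * ‖ p ‖ - 1ℚ) * scale p ≡ 1ℚ
    scale-inverse = *-reciprocal (0<⇒≢0 denominator-pos)

    0<scale : 0ℚ < scale p
    0<scale = let i , 0<i , inv = invert⁺ denominator-pos in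
      subst (0ℚ <_) (≡-by (*-cancelˡ-0 (0<⇒≢0 denominator-pos) (trans (lem (2ℚ * ‖ p ‖ - 1ℚ) (scale p) i)
        (trans (drop-eq _ (- 1ℚ) inv) (drop-eq 0ℚ 1ℚ scale-inverse))))) 0<i
      where
      lem : ∀ d k i → d * (k - i) ≡ 0ℚ + 1ℚ * (d * k - 1ℚ) + - 1ℚ * (d * i - 1ℚ)
      lem = solve-∀ ℚ-ring

    ‖invertBall‖ : ‖ invertBall p ‖ ≡ ‖ p ‖ * scale p
    ‖invertBall‖ = trans (cong₂ _+_ (abs (proj₁ p)) (abs (proj₂ p))) (sym (*-distribʳ-+ (scale p) ∣ proj₁ p ∣ ∣ proj₂ p ∣))
      where
      abs : ∀ z → ∣ z * scale p ∣ ≡ ∣ z ∣ * scale p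
      abs z = trans (∣p*q∣≡∣p∣*∣q∣ z (scale p)) (cong (∣ z ∣ *_) (0≤p⇒∣p∣≡p (<⇒≤ 0<scale)))

    -- For k = 1 / (2n - 1) one has 2nk - 1 = k. Thus the factor can be read off the image, which
    -- yields injectivity.
    scale-from-norm : scale p ≡ 2ℚ * ‖ invertBall p ‖ - 1ℚ
    scale-from-norm = ≡-by (trans (cong (λ n → 2ℚ * n - 1ℚ - scale p) ‖invertBall‖)
      (trans (lem ‖ p ‖ (scale p)) (drop-eq 0ℚ 1ℚ scale-inverse)))
      where
      lem : ∀ n k → 2ℚ * (n * k) - 1ℚ - k ≡ 0ℚ + 1ℚ * ((2ℚ * n - 1ℚ) * k - 1ℚ)
      lem = solve-∀ ℚ-ring

  invertBall-inside : ∀ p → 1ℚ < ‖ p ‖ → ‖ invertBall p ‖ < 1ℚ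
  invertBall-inside p 1<‖p‖ = subst (_< 1ℚ) (sym (‖invertBall‖ p 1≤‖p‖))
    (<-by (0<* (0<-from-< 1<‖p‖) (0<scale p 1≤‖p‖)) (trans (lem ‖ p ‖ (scale p))
       (drop-eq ((‖ p ‖ - 1ℚ) * scale p) (- 1ℚ) (scale-inverse p 1≤‖p‖))))
    where
    1≤‖p‖ = <⇒≤ 1<‖p‖
    lem : ∀ n k → 1ℚ - n * k ≡ (n - 1ℚ) * k + - 1ℚ * ((2ℚ * n - 1ℚ) * k - 1ℚ)
    lem = solve-∀ ℚ-ring

  invertBall-injective : InjectiveOn (λ p → 1ℚ ≤ ‖ p ‖) invertBall
  invertBall-injective p q 1≤p 1≤q eq = cong₂ _,_ (coord (proj₁ p) (proj₁ q) (cong proj₁ eq)) (coord (proj₂ p) (proj₂ q) (cong proj₂ eq))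
    where
    same-scale : scale p ≡ scale q
    same-scale = trans (scale-from-norm p 1≤p) (trans (cong (λ z → 2ℚ * ‖ z ‖ - 1ℚ) eq) (sym (scale-from-norm q 1≤q)))
    lem : ∀ x y k l → l * (y - x) ≡ 0ℚ + x * (k - l) + - 1ℚ * (x * k - y * l)
    lem = solve-∀ ℚ-ring
    coord : ∀ x y → x * scale p ≡ y * scale q → x ≡ y
    coord x y e = ≡-by (*-cancelˡ-0 (0<⇒≢0 (0<scale q 1≤q)) (trans (lem x y (scale p) (scale q))
      (trans (drop-eq _ (- 1ℚ) e) (drop-eq 0ℚ x same-scale))))

  traces-invertBall : Traces invertBall (λ p → 1ℚ ≤ ‖ p ‖)
  traces-invertBall = traces-quadrants λ σ τ →
    traces-projective (form (2ℚ * σ) (2ℚ * τ) (- 1ℚ)) xForm yForm λ (x , y) (1≤ , eqx , eqy) →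
      let den = trans (cong₂ (λ a b → 2ℚ * (a + b) - 1ℚ) eqx eqy) (norm-form σ τ x y) in
      subst (0ℚ <_) den (denominator-pos (x , y) 1≤) ,
      trans (cong (_* (x * scale (x , y))) (sym den)) (coord x (scale (x , y)) (2ℚ * ‖ x , y ‖ - 1ℚ) (scale-inverse (x , y) 1≤) (xForm≡ x y)) ,
      trans (cong (_* (y * scale (x , y))) (sym den)) (coord y (scale (x , y)) (2ℚ * ‖ x , y ‖ - 1ℚ) (scale-inverse (x , y) 1≤) (yForm≡ x y))
    where
    norm-form : ∀ σ τ x y → 2ℚ * (σ * x + τ * y) - 1ℚ ≡ 2ℚ * σ * x + 2ℚ * τ * y + - 1ℚ
    norm-form = solve-∀ ℚ-ring
    lem : ∀ d z k → d * (z * k) ≡ z + z * (d * k - 1ℚ)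
    lem = solve-∀ ℚ-ring
    coord : ∀ z k d {w} → d * k ≡ 1ℚ → w ≡ z → d * (z * k) ≡ w
    coord z k d inv w≡z = trans (lem d z k) (trans (drop-eq z z inv) (sym w≡z))

  -- Dragging the point (−1, 0) to (r, 0)

  height : Point → ℚ
  height p = 1ℚ - ∣ proj₂ p ∣

  -- The quadrilateral with vertices (l, 0), (0, 1), (r, 0), (0, −1).
  Kite : ℚ → ℚ → Point → Set
  Kite l r p = l * height p ≤ proj₁ p × proj₁ p ≤ r * height p

  ¬kite : ∀ l r p → ¬ Kite l r p → proj₁ p < l * height p ⊎ r * height p < proj₁ p
  ¬kite l r p ∉ with l * height p ≤? proj₁ p | proj₁ p ≤? r * height p
  ... | no l≰ | _      = inj₁ (≰⇒> l≰)
  ... | yes _ | no ≰r  = inj₂ (≰⇒> ≰r)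
  ... | yes l≤ | yes ≤r = ⊥-elim (∉ (l≤ , ≤r))

  module Drag (r : ℚ) (0<r : 0ℚ < r) where

    stretch : ℚ → ℚ → ℚ
    stretch s x = x + (r + 1ℚ) * (0ℚ ⊔ (x + 2ℚ * s))

    -- On every horizontal line of height s > 0, the interval [−2s, −s] is stretched onto [−2s, r s].
    drag : Point → Point
    drag p with proj₁ p ≤? 0ℚ
    ... | yes _ = stretch (height p) (proj₁ p) , proj₂ p
    ... | no _  = p

    -- `Outside` suffices for the piecewise formulas, but not for injectivity: at a height s > 0 the
    -- left boundary point -s is sent to the right boundary point rs, which is itself fixed. Hence
    -- `OutsideOrTip` keeps only the tip (-1, 0) from the boundary.
    Outside OutsideOrTip : Point → Set
    Outside p = proj₁ p ≤ - 1ℚ * height p ⊎ r * height p ≤ proj₁ p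
    OutsideOrTip p = p ≡ (- 1ℚ , 0ℚ) ⊎ ¬ Kite (- 1ℚ) r p

    tip-outside : ∀ p → OutsideOrTip p → Outside p
    tip-outside p (inj₁ refl) = inj₁ ≤-refl
    tip-outside p (inj₂ p∉) = ⊎-map <⇒≤ <⇒≤ (¬kite (- 1ℚ) r p p∉)

    private
      0≤r+1 : 0ℚ ≤ r + 1ℚ
      0≤r+1 = 0≤+ (<⇒≤ 0<r) 0≤1

    drag-y : ∀ p → proj₂ (drag p) ≡ proj₂ p
    drag-y p with proj₁ p ≤? 0ℚ
    ... | yes _ = refl
    ... | no _  = refl

    stretch-low : ∀ s x → x + 2ℚ * s ≤ 0ℚ → stretch s x ≡ x
    stretch-low s x low = trans (cong (λ z → x + (r + 1ℚ) * z) (p≥q⇒p⊔q≡p low)) (lem x r)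
      where
      lem : ∀ x r → x + (r + 1ℚ) * 0ℚ ≡ x
      lem = solve-∀ ℚ-ring

    stretch-high : ∀ s x → 0ℚ ≤ x + 2ℚ * s → stretch s x ≡ x + (r + 1ℚ) * (x + 2ℚ * s)
    stretch-high s x high = cong (λ z → x + (r + 1ℚ) * z) (p≤q⇒p⊔q≡q high)

    stretch-mono : ∀ s x y → x < y → stretch s x < stretch s y
    stretch-mono s x y x<y = +-mono-<-≤ x<y
      (*-monoˡ-≤-nonNeg (r + 1ℚ) {{nonNegative 0≤r+1}} (⊔-monoʳ-≤ 0ℚ (+-monoˡ-≤ (2ℚ * s) (<⇒≤ x<y))))

    drag-left : ∀ p → proj₁ p ≤ 0ℚ → proj₁ (drag p) ≡ stretch (height p) (proj₁ p)
    drag-left p x≤0 with proj₁ p ≤? 0ℚ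
    ... | yes _   = refl
    ... | no x≰0 = ⊥-elim (x≰0 x≤0)

    drag-low : ∀ p → proj₁ p + 2ℚ * height p ≤ 0ℚ → drag p ≡ p
    drag-low p low with proj₁ p ≤? 0ℚ
    ... | yes _ = cong (_, proj₂ p) (stretch-low (height p) (proj₁ p) low)
    ... | no _  = refl

    drag-right : ∀ p → 0ℚ < proj₁ p → drag p ≡ p
    drag-right p 0<x with proj₁ p ≤? 0ℚ
    ... | yes x≤0 = ⊥-elim (<-absurd 0<x x≤0)
    ... | no _    = refl

    outside-left : ∀ p → Outside p → proj₁ p ≤ 0ℚ → 0ℚ < height p → proj₁ p ≤ - 1ℚ * height p
    outside-left p (inj₁ x≤-s) x≤0 0<s = x≤-s
    outside-left p (inj₂ rs≤x) x≤0 0<s = ⊥-elim (<-absurd (0<* 0<r 0<s) (≤-trans rs≤x x≤0))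

    private
      0<s : ∀ x s → x ≤ 0ℚ → 0ℚ < x + 2ℚ * s → 0ℚ < s
      0<s x s x≤0 high with s ≤? 0ℚ
      ... | no s≰0  = ≰⇒> s≰0
      ... | yes s≤0 = ⊥-elim (<-absurd high (≤-by (0≤+ (0≤-from-≤ x≤0) (0≤+ (0≤-from-≤ s≤0) (0≤-from-≤ s≤0))) (lem x s)))
        where
        lem : ∀ x s → 0ℚ - (x + 2ℚ * s) ≡ 0ℚ - x + (0ℚ - s + (0ℚ - s))
        lem = solve-∀ ℚ-ring

    stretch-bounded : ∀ s x → 0ℚ ≤ x + 2ℚ * s → x ≤ - 1ℚ * s → - 2ℚ * s ≤ stretch s x × stretch s x ≤ r * s
    stretch-bounded s x high x≤-s =
      subst (- 2ℚ * s ≤_) (sym (stretch-high s x high))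
        (≤-by (0≤+ high (0≤* 0≤r+1 high)) (low s x r)) ,
      subst (_≤ r * s) (sym (stretch-high s x high))
        (≤-by (0≤+ (0≤-from-≤ x≤-s) (0≤* 0≤r+1 (0≤-from-≤ x≤-s))) (up s x r))
      where
      low : ∀ s x r → x + (r + 1ℚ) * (x + 2ℚ * s) - - 2ℚ * s ≡ x + 2ℚ * s + (r + 1ℚ) * (x + 2ℚ * s)
      low = solve-∀ ℚ-ring
      up : ∀ s x r → r * s - (x + (r + 1ℚ) * (x + 2ℚ * s)) ≡ - 1ℚ * s - x + (r + 1ℚ) * (- 1ℚ * s - x)
      up = solve-∀ ℚ-ring

    -- A point that is moved has -2s < x ≤ -s and lands between -2s and rs. The change is thus
    -- confined to a kite that the rest of the curve of e will meet only at (r, 0).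
    drag-local : ∀ p → Outside p → drag p ≡ p ⊎ Kite (- 2ℚ) r (drag p)
    drag-local p out with proj₁ p + 2ℚ * height p ≤? 0ℚ
    ... | yes low = inj₁ (drag-low p low)
    ... | no ≰low with proj₁ p ≤? 0ℚ
    ...   | no x≰0  = inj₁ refl
    ...   | yes x≤0 = inj₂ (stretch-bounded (height p) (proj₁ p) (<⇒≤ (≰⇒> ≰low))
                        (outside-left p out x≤0 (0<s (proj₁ p) (height p) x≤0 (≰⇒> ≰low))))

    -- Keeps v in place. To the left of the wide kite x is below the threshold -2s; to its right, x
    -- ≤ 0 forces s ≤ 0, and x + 2s ≤ 0 again.
    drag-far : ∀ p → ¬ Kite (- 2ℚ) r p → drag p ≡ p
    drag-far p far with proj₁ p ≤? 0ℚ
    ... | no _ = refl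
    ... | yes x≤0 = cong (_, proj₂ p) (stretch-low (height p) (proj₁ p) ([ left , right ]′ (¬kite (- 2ℚ) r p far)))
      where
      left : proj₁ p < - 2ℚ * height p → proj₁ p + 2ℚ * height p ≤ 0ℚ
      left h = ≤-by (<⇒≤ (0<-from-< h)) (lem (proj₁ p) (height p))
        where
        lem : ∀ x s → 0ℚ - (x + 2ℚ * s) ≡ - 2ℚ * s - x
        lem = solve-∀ ℚ-ring
      right : r * height p < proj₁ p → proj₁ p + 2ℚ * height p ≤ 0ℚ
      right h = ≤-by (0≤+ (0≤-from-≤ x≤0) (0≤+ 0≤-s 0≤-s)) (lem (proj₁ p) (height p))
        where
        0≤-s : 0ℚ ≤ 0ℚ - height p
        0≤-s = 0≤-cancelˡ 0<r (≤-by (0≤+ (<⇒≤ (0<-from-< h)) (0≤-from-≤ x≤0)) (lem′ r (height p) (proj₁ p)))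
          where
          lem′ : ∀ r s x → r * (0ℚ - s) - 0ℚ ≡ x - r * s + (0ℚ - x)
          lem′ = solve-∀ ℚ-ring
        lem : ∀ x s → 0ℚ - (x + 2ℚ * s) ≡ 0ℚ - x + (0ℚ - s + (0ℚ - s))
        lem = solve-∀ ℚ-ring

    drag-tip : drag (- 1ℚ , 0ℚ) ≡ (r , 0ℚ)
    drag-tip = cong (_, 0ℚ) (lem r)
      where
      lem : ∀ r → - 1ℚ + (r + 1ℚ) * 1ℚ ≡ r
      lem = solve-∀ ℚ-ring

    private
      -- A moved point stays within x ≤ rs. A fixed point with 0 < x at the same place would
      -- therefore lie in the kite without being its tip.
      left≢right : ∀ p q → Outside p → OutsideOrTip q → proj₁ p ≤ 0ℚ → 0ℚ < proj₁ q →
                   height p ≡ height q → proj₁ (drag p) ≡ proj₁ q → ⊥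
      left≢right p q out-p out-q x≤0 0<x′ s≡ eq with proj₁ p + 2ℚ * height p ≤? 0ℚ
      ... | yes low = <-absurd 0<x′ (subst (_≤ 0ℚ) (trans (sym (cong proj₁ (drag-low p low))) eq) x≤0)
      ... | no ≰low = impossible out-q
        where
        high = ≰⇒> ≰low
        0<sp = 0<s (proj₁ p) (height p) x≤0 high
        x′≤rs : proj₁ q ≤ r * height q
        x′≤rs = subst₂ _≤_ (trans (sym (drag-left p x≤0)) eq) (cong (r *_) s≡)
          (proj₂ (stretch-bounded (height p) (proj₁ p) (<⇒≤ high) (outside-left p out-p x≤0 0<sp)))
        0<sq : 0ℚ < height q
        0<sq = subst (0ℚ <_) s≡ 0<sp
        impossible : OutsideOrTip q → ⊥
        impossible (inj₁ refl) = <-absurd 0<x′ (<⇒≤ (negative⁻¹ (- 1ℚ)))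
        impossible (inj₂ q∉) = q∉ (<⇒≤ (<-trans (<-by 0<sq (lem (height q))) 0<x′) , x′≤rs)
          where
          lem : ∀ s → 0ℚ - - 1ℚ * s ≡ s
          lem = solve-∀ ℚ-ring

    -- Heights are preserved, so each horizontal line can be treated alone; there the map is
    -- strictly increasing on x ≤ 0 and the identity on x > 0.
    drag-injective : InjectiveOn OutsideOrTip drag
    drag-injective p q out-p out-q eq = cong₂ _,_ x≡ y≡
      where
      y≡ : proj₂ p ≡ proj₂ q
      y≡ = trans (sym (drag-y p)) (trans (cong proj₂ eq) (drag-y q))
      s≡ : height p ≡ height q
      s≡ = cong (λ y → 1ℚ - ∣ y ∣) y≡
      stretched : proj₁ p ≤ 0ℚ → proj₁ q ≤ 0ℚ → stretch (height q) (proj₁ p) ≡ stretch (height q) (proj₁ q)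
      stretched x≤0 x′≤0 = trans (cong (λ s → stretch s (proj₁ p)) (sym s≡))
        (trans (sym (drag-left p x≤0)) (trans (cong proj₁ eq) (drag-left q x′≤0)))
      x≡ : proj₁ p ≡ proj₁ q
      x≡ = go (proj₁ p ≤? 0ℚ) (proj₁ q ≤? 0ℚ)
        where
        go : Dec (proj₁ p ≤ 0ℚ) → Dec (proj₁ q ≤ 0ℚ) → proj₁ p ≡ proj₁ q
        go (no x≰0) (no x′≰0) =
          trans (sym (cong proj₁ (drag-right p (≰⇒> x≰0)))) (trans (cong proj₁ eq) (cong proj₁ (drag-right q (≰⇒> x′≰0))))
        go (yes x≤0) (no x′≰0) = ⊥-elim (left≢right p q (tip-outside p out-p) out-q x≤0 (≰⇒> x′≰0) s≡
          (trans (cong proj₁ eq) (cong proj₁ (drag-right q (≰⇒> x′≰0)))))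
        go (no x≰0) (yes x′≤0) = ⊥-elim (left≢right q p (tip-outside q out-q) out-p x′≤0 (≰⇒> x≰0) (sym s≡)
          (trans (cong proj₁ (sym eq)) (cong proj₁ (drag-right p (≰⇒> x≰0)))))
        go (yes x≤0) (yes x′≤0) with <-cmp (proj₁ p) (proj₁ q)
        ... | tri< lt _ _ = ⊥-elim (<-absurd (stretch-mono (height q) (proj₁ p) (proj₁ q) lt) (≤-reflexive (sym (stretched x≤0 x′≤0))))
        ... | tri≈ _ e _  = e
        ... | tri> _ _ gt = ⊥-elim (<-absurd (stretch-mono (height q) (proj₁ q) (proj₁ p) gt) (≤-reflexive (stretched x≤0 x′≤0)))

    traces-drag : Traces drag Outside
    traces-drag = traces-split xForm (traces-id right)
      (traces-split yForm (half 1ℚ λ x y 0≤y → abs⁺ (subst (0ℚ ≤_) (yForm≡ x y) 0≤y))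
                          (half (- 1ℚ) λ x y y≤0 → abs⁻ (subst (_≤ 0ℚ) (yForm≡ x y) y≤0)))
      where
      -- The two clauses of `drag` meet at x = 0. An outside point there has height s ≤ 0, so its
      -- threshold is not passed and the stretch fixes it.
      right : ∀ p → Outside p × 0ℚ ≤ ⟦ xForm ⟧ p → drag p ≡ p
      right p (out , 0≤x′) with proj₁ p ≤? 0ℚ
      ... | no _    = refl
      ... | yes x≤0 = cong (_, proj₂ p) (stretch-low (height p) (proj₁ p)
                        (≤-by (0≤+ (0≤-from-≤ x≤0) (0≤+ (0≤-from-≤ s≤0) (0≤-from-≤ s≤0))) (lem (proj₁ p) (height p))))
        where
        lem : ∀ x s → 0ℚ - (x + 2ℚ * s) ≡ 0ℚ - x + (0ℚ - s + (0ℚ - s))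
        lem = solve-∀ ℚ-ring
        0≤x : 0ℚ ≤ proj₁ p
        0≤x = subst (0ℚ ≤_) (xForm≡ (proj₁ p) (proj₂ p)) 0≤x′
        s≤0 : height p ≤ 0ℚ
        s≤0 with height p ≤? 0ℚ
        ... | yes s≤0 = s≤0
        ... | no s≰0 = ⊥-elim (<-absurd (≰⇒> s≰0) (≤-by (0≤+ (0≤-from-≤ (outside-left p out x≤0 (≰⇒> s≰0))) 0≤x) (gap (proj₁ p) (height p))))
          where
          gap : ∀ x s → 0ℚ - s ≡ - 1ℚ * s - x + x
          gap = solve-∀ ℚ-ring

      -- Once the sign of y is fixed, s = 1 - τy is affine, and so are the threshold x + 2s and the
      -- map on either side of it.
      half : ∀ τ {R : Point → Set} → (∀ x y → R (x , y) → ∣ y ∣ ≡ τ * y) →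
              Traces drag (λ p → (Outside p × ⟦ xForm ⟧ p ≤ 0ℚ) × R p)
      half τ {R} abs = traces-split (form 1ℚ (- 2ℚ * τ) 2ℚ)
        (traces-affine (form (r + 2ℚ) (- 2ℚ * (r + 1ℚ) * τ) (2ℚ * (r + 1ℚ))) yForm
          λ (x , y) (((_ , x≤0) , Rp) , high) →
            trans (drag-left (x , y) (subst (_≤ 0ℚ) (xForm≡ x y) x≤0))
              (trans (stretch-high (height (x , y)) x (subst (0ℚ ≤_) (sym (threshold x y (abs x y Rp))) high))
                (trans (cong (λ a → x + (r + 1ℚ) * (x + 2ℚ * (1ℚ - a))) (abs x y Rp)) (lem r τ x y))) ,
            trans (drag-y (x , y)) (sym (yForm≡ x y)))
        (traces-id λ (x , y) (((_ , x≤0) , Rp) , low) →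
            drag-low (x , y) (subst (_≤ 0ℚ) (sym (threshold x y (abs x y Rp))) low))
        where
        lem′ : ∀ τ x y → x + 2ℚ * (1ℚ - τ * y) ≡ 1ℚ * x + - 2ℚ * τ * y + 2ℚ
        lem′ = solve-∀ ℚ-ring
        threshold : ∀ x y → ∣ y ∣ ≡ τ * y → x + 2ℚ * (1ℚ - ∣ y ∣) ≡ ⟦ form 1ℚ (- 2ℚ * τ) 2ℚ ⟧ (x , y)
        threshold x y eq = trans (cong (λ a → x + 2ℚ * (1ℚ - a)) eq) (lem′ τ x y)
        lem : ∀ r τ x y → x + (r + 1ℚ) * (x + 2ℚ * (1ℚ - τ * y)) ≡
              (r + 2ℚ) * x + - 2ℚ * (r + 1ℚ) * τ * y + 2ℚ * (r + 1ℚ)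
        lem = solve-∀ ℚ-ring

  -- Position of a segment relative to a line

  0<⊓ : ∀ {p q} → 0ℚ < p → 0ℚ < q → 0ℚ < p ⊓ q
  0<⊓ {p} {q} 0<p 0<q with ⊓-sel p q
  ... | inj₁ eq = subst (0ℚ <_) (sym eq) 0<p
  ... | inj₂ eq = subst (0ℚ <_) (sym eq) 0<q

  0<-neg : ∀ {p} → p < 0ℚ → 0ℚ < 0ℚ - p
  0<-neg = 0<-from-<

  ≤-on-seg : ∀ L {a b p μ} → μ ≤ ⟦ L ⟧ a → μ ≤ ⟦ L ⟧ b → OnSeg a b p → μ ≤ ⟦ L ⟧ p
  ≤-on-seg L@(form α β γ) {a} {b} {p} {μ} μ≤A μ≤B p∈ =
    ≤-by (nonneg-on-seg (form α β (γ - μ)) (shift a μ≤A) (shift b μ≤B) p∈) (lem (α * proj₁ p + β * proj₂ p) γ μ)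
    where
    lem : ∀ p q μ → p + q - μ ≡ p + (q - μ)
    lem = solve-∀ ℚ-ring
    shift : ∀ q → μ ≤ ⟦ L ⟧ q → 0ℚ ≤ ⟦ form α β (γ - μ) ⟧ q
    shift q μ≤ = subst (0ℚ ≤_) (lem (α * proj₁ q + β * proj₂ q) γ μ) (0≤-from-≤ μ≤)

  ≥-on-seg : ∀ L {a b p μ} → ⟦ L ⟧ a ≤ μ → ⟦ L ⟧ b ≤ μ → OnSeg a b p → ⟦ L ⟧ p ≤ μ
  ≥-on-seg L@(form α β γ) {a} {b} {p} {μ} A≤μ B≤μ p∈ =
    ≤-by (0≤-from-≤ (nonpos-on-seg (form α β (γ - μ)) (shift a A≤μ) (shift b B≤μ) p∈)) (lem′ (α * proj₁ p + β * proj₂ p) γ μ)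
    where
    lem′ : ∀ p q μ → μ - (p + q) ≡ 0ℚ - (p + (q - μ))
    lem′ = solve-∀ ℚ-ring
    shift : ∀ q → ⟦ L ⟧ q ≤ μ → ⟦ form α β (γ - μ) ⟧ q ≤ 0ℚ
    shift q ≤μ = ≤-by (0≤-from-≤ ≤μ) (sym (lem′ (α * proj₁ q + β * proj₂ q) γ μ))

  -- The margins μ take the place of compactness: a form without zeros on a segment is bounded away
  -- from 0 by its smaller absolute value at the ends.
  SignOnSeg : Form → Point → Point → Set
  SignOnSeg L a b =
    (∃ λ μ → 0ℚ < μ × ∀ p → OnSeg a b p → μ ≤ ⟦ L ⟧ p) ⊎
    (∃ λ μ → 0ℚ < μ × ∀ p → OnSeg a b p → ⟦ L ⟧ p ≤ 0ℚ - μ) ⊎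
    (∃ λ c → OnSeg a b c × ⟦ L ⟧ c ≡ 0ℚ)

  sign-on-seg : ∀ L a b → SignOnSeg L a b
  sign-on-seg L a b = go (⟦ L ⟧ a ≤? 0ℚ) (0ℚ ≤? ⟦ L ⟧ a) (⟦ L ⟧ b ≤? 0ℚ) (0ℚ ≤? ⟦ L ⟧ b)
    where
    A = ⟦ L ⟧ a
    B = ⟦ L ⟧ b
    below : ∀ {p μ} → μ ≤ 0ℚ - p → p ≤ 0ℚ - μ
    below {p} {μ} h = ≤-by (0≤-from-≤ h) (lem p μ)
      where
      lem : ∀ p μ → 0ℚ - μ - p ≡ 0ℚ - p - μ
      lem = solve-∀ ℚ-ring
    go : Dec (A ≤ 0ℚ) → Dec (0ℚ ≤ A) → Dec (B ≤ 0ℚ) → Dec (0ℚ ≤ B) → SignOnSeg L a b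
    go (yes A≤0) _ _ (yes 0≤B) = inj₂ (inj₂ (zero-on-seg L a b A≤0 0≤B))
    go _ (yes 0≤A) (yes B≤0) _ =
      let c , c∈ , eq = zero-on-seg L b a B≤0 0≤A in inj₂ (inj₂ (c , seg-rev b a c∈ , eq))
    go (no A≰0) _ (no B≰0) _ = inj₁ (A ⊓ B , 0<⊓ (≰⇒> A≰0) (≰⇒> B≰0) ,
      λ p → ≤-on-seg L (p⊓q≤p A B) (p⊓q≤q A B))
    go _ (no 0≰A) _ (no 0≰B) = inj₂ (inj₁ ((0ℚ - A) ⊓ (0ℚ - B) , 0<⊓ (0<-neg (≰⇒> 0≰A)) (0<-neg (≰⇒> 0≰B)) ,
      λ p → ≥-on-seg L (below (p⊓q≤p (0ℚ - A) (0ℚ - B))) (below (p⊓q≤q (0ℚ - A) (0ℚ - B)))))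
    go (yes A≤0) (yes 0≤A) (no B≰0) (no 0≰B) = ⊥-elim (0≰B (<⇒≤ (≰⇒> B≰0)))
    go (no A≰0) (no 0≰A) (yes _) _ = ⊥-elim (0≰A (<⇒≤ (≰⇒> A≰0)))

  -- In the transversal case `m` is the inverse slope, which stays finite for vertical segments. A
  -- single point on the axis counts as `within`.
  data AxisPosition (a b : Point) : Set where
    off    : ∀ μ → 0ℚ < μ → (∀ p → OnSeg a b p → μ ≤ ∣ proj₂ p ∣) → AxisPosition a b
    within : (∀ p → OnSeg a b p → proj₂ p ≡ 0ℚ) → AxisPosition a b
    meets  : ∀ c → OnSeg a b c → proj₂ c ≡ 0ℚ → ∀ m → (∀ p → OnSeg a b p → proj₁ p - proj₁ c ≡ m * proj₂ p) →
             AxisPosition a b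

  axis-position : ∀ a b → AxisPosition a b
  axis-position a b = go (sign-on-seg yForm a b)
    where
    y≡ : ∀ p → ⟦ yForm ⟧ p ≡ proj₂ p
    y≡ p = yForm≡ (proj₁ p) (proj₂ p)
    go : SignOnSeg yForm a b → AxisPosition a b
    go (inj₁ (μ , 0<μ , h)) = off μ 0<μ λ p p∈ → ≤-trans (subst (μ ≤_) (y≡ p) (h p p∈)) (p≤∣p∣ (proj₂ p))
    go (inj₂ (inj₁ (μ , 0<μ , h))) = off μ 0<μ λ p p∈ →
      ≤-trans (≤-by (0≤-from-≤ (subst (_≤ 0ℚ - μ) (y≡ p) (h p p∈))) (lem (proj₂ p) μ)) (-p≤∣p∣ (proj₂ p))
      where
      lem : ∀ y μ → - y - μ ≡ 0ℚ - μ - y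
      lem = solve-∀ ℚ-ring
    go (inj₂ (inj₂ (c , c∈ , eq))) with proj₂ b - proj₂ a ≟ 0ℚ
    ... | yes flat = within λ p p∈ → trans (same p c p∈ c∈) (trans (sym (y≡ c)) eq)
      where
      lem : ∀ A d s t → A + s * d - (A + t * d) ≡ 0ℚ + (s - t) * (d - 0ℚ)
      lem = solve-∀ ℚ-ring
      same : ∀ p c → OnSeg a b p → OnSeg a b c → proj₂ p ≡ proj₂ c
      same p c (s , _ , _ , refl) (t , _ , _ , refl) =
        sym (≡-by (trans (lem (proj₂ a) (proj₂ b - proj₂ a) s t) (drop-eq 0ℚ (s - t) flat)))
    ... | no steep = meets c c∈ y₀ ((proj₁ b - proj₁ a) * i) (λ p p∈ → slope p c p∈ c∈ y₀)
      where
      i = proj₁ (invert steep)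
      y₀ : proj₂ c ≡ 0ℚ
      y₀ = trans (sym (y≡ c)) eq
      lem : ∀ X d A e i s t → d * i * (A + s * e) - (X + s * d - (X + t * d)) ≡
            0ℚ + d * i * (A + t * e - 0ℚ) + d * (s - t) * (e * i - 1ℚ)
      lem = solve-∀ ℚ-ring
      slope : ∀ p c → OnSeg a b p → OnSeg a b c → proj₂ c ≡ 0ℚ →
              proj₁ p - proj₁ c ≡ (proj₁ b - proj₁ a) * i * proj₂ p
      slope p c (s , _ , _ , refl) (t , _ , _ , refl) y₀ = ≡-by
        (trans (lem (proj₁ a) (proj₁ b - proj₁ a) (proj₂ a) (proj₂ b - proj₂ a) i s t)
        (trans (drop-eq _ ((proj₁ b - proj₁ a) * (s - t)) (proj₂ (invert steep)))
               (drop-eq 0ℚ ((proj₁ b - proj₁ a) * i) y₀)))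

  -- Uniform estimates on segments and drawings

  Eventually : (ℚ → Set) → Set
  Eventually P = ∃ λ K₀ → ∀ K → K₀ ≤ K → P K

  eventually-map : ∀ {P Q : ℚ → Set} → (∀ K → P K → Q K) → Eventually P → Eventually Q
  eventually-map P⇒Q (K₀ , h) = K₀ , λ K K₀≤K → P⇒Q K (h K K₀≤K)

  eventually-and : ∀ {P Q : ℚ → Set} → Eventually P → Eventually Q → Eventually (λ K → P K × Q K)
  eventually-and (K₁ , h₁) (K₂ , h₂) = K₁ ⊔ K₂ , λ K K≥ →
    h₁ K (≤-trans (p≤p⊔q K₁ K₂) K≥) , h₂ K (≤-trans (p≤q⊔p K₁ K₂) K≥)

  eventually-fin : ∀ {n} {P : Fin n → ℚ → Set} → (∀ i → Eventually (P i)) → Eventually (λ K → ∀ i → P i K)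
  eventually-fin {ℕ.zero}  h = 0ℚ , λ _ _ ()
  eventually-fin {ℕ.suc n} h = eventually-map (λ { _ (h₀ , _) zero → h₀ ; _ (_ , hs) (suc i) → hs i })
    (eventually-and (h zero) (eventually-fin (h ∘ suc)))

  -- An estimate that a single segment satisfies from some threshold on. A drawing consists of
  -- finitely many segments, so one threshold then serves for all of it.
  Tame : (Point → Set) → (ℚ → Point → Set) → Set
  Tame Q S = ∀ a b → (∀ p → OnSeg a b p → Q p) → Eventually (λ K → ∀ p → OnSeg a b p → S K p)

  tame-path : ∀ {Q S} → Tame Q S → ∀ a cs b → (∀ p → OnPath a cs b p → Q p) →
              Eventually (λ K → ∀ p → OnPath a cs b p → S K p)
  tame-path tame a []       b Q-path = tame a b Q-path
  tame-path tame a (c ∷ cs) b Q-path =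
    eventually-map (λ { K (h₁ , h₂) p → [ h₁ p , h₂ p ]′ })
      (eventually-and (tame a c λ p → Q-path p ∘ inj₁) (tame-path tame c cs b λ p → Q-path p ∘ inj₂))

  -- The quadrilateral of height 1/K over [l, r] is pulled back from Kite l r by (x, y) ↦ (x, K y).
  tame-thin : ∀ l r → l < 0ℚ → 0ℚ < r →
    Tame (λ p → proj₂ p ≡ 0ℚ → proj₁ p ≤ l ⊎ r ≤ proj₁ p)
         (λ K p → Kite l r (proj₁ p , K * proj₂ p) → proj₂ p ≡ 0ℚ)
  tame-thin l r l<0 0<r a b Q-seg = go (axis-position a b)
    where
    0<-l : 0ℚ < 0ℚ - l
    0<-l = 0<-neg l<0

    abs-K : ∀ K y → 0ℚ ≤ K → ∣ K * y ∣ ≡ K * ∣ y ∣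
    abs-K K y 0≤K = trans (∣p*q∣≡∣p∣*∣q∣ K y) (cong (_* ∣ y ∣) (0≤p⇒∣p∣≡p 0≤K))

    -- The kite gives hK|y| ≤ e and the slope of the segment gives e ≤ M|y|; once hK ≥ M + 1, only y
    -- = 0 remains. Here h is -l or r, and `i` is its inverse.
    squeeze : ∀ h i M K y e → 0ℚ < h → 0ℚ < i → h * i ≡ 1ℚ → 0ℚ ≤ M → (M + 1ℚ) * i ≤ K →
              h * (K * ∣ y ∣) ≤ e → e ≤ M * ∣ y ∣ → y ≡ 0ℚ
    squeeze h i M K y e 0<h 0<i inv 0≤M K≥ low high =
      ∣p∣≡0⇒p≡0 y (≤-antisym (≤-by (0≤+ (0≤+ (0≤-from-≤ low) (0≤-from-≤ high))
        (0≤* (0≤* (<⇒≤ 0<h) (0≤∣p∣ y)) (0≤-from-≤ K≥)))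
        (trans (lem h i M K ∣ y ∣ e) (drop-eq _ ((M + 1ℚ) * ∣ y ∣) inv))) (0≤∣p∣ y))
      where
      lem : ∀ h i M K y e → 0ℚ - y ≡ e - h * (K * y) + (M * y - e) + h * y * (K - (M + 1ℚ) * i)
              + (M + 1ℚ) * y * (h * i - 1ℚ)
      lem = solve-∀ ℚ-ring

    bound : ∀ m y → m * y ≤ ∣ m ∣ * ∣ y ∣
    bound m y = subst (m * y ≤_) (∣p*q∣≡∣p∣*∣q∣ m y) (p≤∣p∣ (m * y))

    0≤K : ∀ h i M K → 0ℚ < i → 0ℚ ≤ M → (M + 1ℚ) * i ≤ K → 0ℚ ≤ K
    0≤K h i M K 0<i 0≤M = ≤-trans (0≤* (0≤+ 0≤M 0≤1) (<⇒≤ 0<i))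

    go : AxisPosition a b → Eventually (λ K → ∀ p → OnSeg a b p → Kite l r (proj₁ p , K * proj₂ p) → proj₂ p ≡ 0ℚ)
    go (within y≡0) = 0ℚ , λ K _ p p∈ _ → y≡0 p p∈
    -- With K ≥ 2/μ the height 1 - K|y| is at most -1, whereas points of a kite with l < r have
    -- nonnegative height.
    go (off μ 0<μ h) = (1ℚ + 1ℚ) * i , λ K K≥ p p∈ (lo , hi) →
      let 0≤K = ≤-trans (0≤* (0≤+ 0≤1 0≤1) (<⇒≤ 0<i)) K≥
          s   = 1ℚ - ∣ K * proj₂ p ∣
          0≤s = 0≤-cancelˡ {r - l} (0<r-l)
                  (≤-by (0≤+ (0≤-from-≤ lo) (0≤-from-≤ hi)) (lem₁ l r s (proj₁ p)))
      in ⊥-elim (<-absurd 0<1 (≤-by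
          (0≤+ (0≤+ 0≤s (0≤* 0≤K (0≤-from-≤ (h p p∈)))) (0≤* (<⇒≤ 0<μ) (0≤-from-≤ K≥)))
          (trans (lem₂ K ∣ proj₂ p ∣ μ i) (trans (drop-eq _ 2ℚ inv)
            (cong (λ z → 1ℚ - z + K * (∣ proj₂ p ∣ - μ) + μ * (K - (1ℚ + 1ℚ) * i)) (sym (abs-K K (proj₂ p) 0≤K)))))))
      where
      inverse = invert⁺ 0<μ
      i = proj₁ inverse
      0<i = proj₁ (proj₂ inverse)
      inv = proj₂ (proj₂ inverse)
      0<r-l : 0ℚ < r - l
      0<r-l = 0<-from-< (<-trans l<0 0<r)
      lem₁ : ∀ l r s x → (r - l) * s - 0ℚ ≡ x - l * s + (r * s - x)
      lem₁ = solve-∀ ℚ-ring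
      lem₂ : ∀ K y μ i → 0ℚ - 1ℚ ≡ 1ℚ - K * y + K * (y - μ) + μ * (K - (1ℚ + 1ℚ) * i) + 2ℚ * (μ * i - 1ℚ)
      lem₂ = solve-∀ ℚ-ring
    go (meets c c∈ y₀ m slope) = side (Q-seg c c∈ y₀)
      where
      side : proj₁ c ≤ l ⊎ r ≤ proj₁ c → Eventually _
      side (inj₁ c≤l) = (∣ m ∣ + 1ℚ) * i , λ K K≥ p p∈ (lo , _) →
        let y = proj₂ p ; 0≤K′ = 0≤K (0ℚ - l) i ∣ m ∣ K 0<i (0≤∣p∣ m) K≥ in
        squeeze (0ℚ - l) i ∣ m ∣ K y (m * y) 0<-l 0<i inv (0≤∣p∣ m) K≥
          (≤-by (0≤+ (0≤-from-≤ lo) (0≤-from-≤ c≤l))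
            (trans (lem l K ∣ y ∣ (m * y) (proj₁ p) (proj₁ c))
              (trans (drop-eq _ (- 1ℚ) (slope p p∈)) (cong (λ z → proj₁ p - l * (1ℚ - z) + (l - proj₁ c)) (sym (abs-K K y 0≤K′))))))
          (bound m y)
        where
        inverse = invert⁺ 0<-l
        i = proj₁ inverse
        0<i = proj₁ (proj₂ inverse)
        inv = proj₂ (proj₂ inverse)
        lem : ∀ l K y e x c → e - (0ℚ - l) * (K * y) ≡ x - l * (1ℚ - K * y) + (l - c) + - 1ℚ * (x - c - e)
        lem = solve-∀ ℚ-ring
      side (inj₂ r≤c) = (∣ - m ∣ + 1ℚ) * i , λ K K≥ p p∈ (_ , hi) →
        let y = proj₂ p ; 0≤K′ = 0≤K r i ∣ - m ∣ K 0<i (0≤∣p∣ (- m)) K≥ in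
        squeeze r i ∣ - m ∣ K y (- m * y) 0<r 0<i inv (0≤∣p∣ (- m)) K≥
          (≤-by (0≤+ (0≤-from-≤ hi) (0≤-from-≤ r≤c))
            (trans (lem r K ∣ y ∣ m y (proj₁ p) (proj₁ c))
              (trans (drop-eq _ 1ℚ (slope p p∈)) (cong (λ z → r * (1ℚ - z) - proj₁ p + (proj₁ c - r)) (sym (abs-K K y 0≤K′))))))
          (bound (- m) y)
        where
        inverse = invert⁺ 0<r
        i = proj₁ inverse
        0<i = proj₁ (proj₂ inverse)
        inv = proj₂ (proj₂ inverse)
        lem : ∀ r K a m y x c → - m * y - r * (K * a) ≡ r * (1ℚ - K * a) - x + (c - r) + 1ℚ * (x - c - m * y)
        lem = solve-∀ ℚ-ring

  origin : Point
  origin = 0ℚ , 0ℚ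

  -- A segment that misses the origin keeps a positive distance from it, so for large K it has no
  -- point on the axis with -1/K ≤ x ≤ 0. This makes room behind u for the drag.
  tame-behind : Tame (_≢ origin) (λ K p → proj₂ p ≡ 0ℚ → - 1ℚ ≤ K * proj₁ p → 0ℚ < proj₁ p)
  tame-behind a b Q-seg = go (axis-position a b)
    where
    Goal = Eventually (λ K → ∀ p → OnSeg a b p → proj₂ p ≡ 0ℚ → - 1ℚ ≤ K * proj₁ p → 0ℚ < proj₁ p)

    far-left : ∀ μ → 0ℚ < μ → (∀ p → OnSeg a b p → proj₂ p ≡ 0ℚ → proj₁ p ≤ 0ℚ - μ) → Goal
    far-left μ 0<μ h = (1ℚ + 1ℚ) * i , λ K K≥ p p∈ y≡0 -1≤Kx →
      let 0≤K = ≤-trans (0≤* (0≤+ 0≤1 0≤1) (<⇒≤ 0<i)) K≥ in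
      ⊥-elim (<-absurd 0<1 (≤-by
        (0≤+ (0≤+ (0≤-from-≤ -1≤Kx) (0≤* 0≤K (0≤-from-≤ (h p p∈ y≡0)))) (0≤* (<⇒≤ 0<μ) (0≤-from-≤ K≥)))
        (trans (lem K (proj₁ p) μ i) (drop-eq _ 2ℚ inv))))
      where
      inverse = invert⁺ 0<μ
      i = proj₁ inverse
      0<i = proj₁ (proj₂ inverse)
      inv = proj₂ (proj₂ inverse)
      lem : ∀ K x μ i → 0ℚ - 1ℚ ≡ K * x - - 1ℚ + K * (0ℚ - μ - x) + μ * (K - (1ℚ + 1ℚ) * i) + 2ℚ * (μ * i - 1ℚ)
      lem = solve-∀ ℚ-ring

    x≡ : ∀ p → ⟦ xForm ⟧ p ≡ proj₁ p
    x≡ p = xForm≡ (proj₁ p) (proj₂ p)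

    go : AxisPosition a b → Goal
    go (off μ 0<μ h) = 0ℚ , λ K _ p p∈ y≡0 _ → ⊥-elim (<-absurd 0<μ (subst (λ y → μ ≤ ∣ y ∣) y≡0 (h p p∈)))
    go (within y≡0) = sign (sign-on-seg xForm a b)
      where
      sign : SignOnSeg xForm a b → Goal
      sign (inj₁ (μ , 0<μ , h)) = 0ℚ , λ K _ p p∈ _ _ → <-≤-trans 0<μ (subst (μ ≤_) (x≡ p) (h p p∈))
      sign (inj₂ (inj₁ (μ , 0<μ , h))) = far-left μ 0<μ λ p p∈ _ → subst (_≤ 0ℚ - μ) (x≡ p) (h p p∈)
      sign (inj₂ (inj₂ (c , c∈ , eq))) = ⊥-elim (Q-seg c c∈ (cong₂ _,_ (trans (sym (x≡ c)) eq) (y≡0 c c∈)))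
    go (meets c c∈ y₀ m slope) = sign (<-cmp (proj₁ c) 0ℚ)
      where
      lem : ∀ x c m y → c - x ≡ 0ℚ + - 1ℚ * (x - c - m * y) + - m * (y - 0ℚ)
      lem = solve-∀ ℚ-ring
      same : ∀ p → OnSeg a b p → proj₂ p ≡ 0ℚ → proj₁ p ≡ proj₁ c
      same p p∈ y≡0 = ≡-by (trans (lem (proj₁ p) (proj₁ c) m (proj₂ p))
        (trans (drop-eq _ (- m) y≡0) (drop-eq 0ℚ (- 1ℚ) (slope p p∈))))
      sign : _ → Goal
      sign (tri> _ _ 0<c) = 0ℚ , λ K _ p p∈ y≡0 _ → subst (0ℚ <_) (sym (same p p∈ y≡0)) 0<c
      sign (tri≈ _ c≡0 _) = ⊥-elim (Q-seg c c∈ (cong₂ _,_ c≡0 y₀))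
      sign (tri< c<0 _ _) = far-left (0ℚ - proj₁ c) (0<-neg c<0) λ p p∈ y≡0 →
        ≤-reflexive (trans (same p p∈ y≡0) (lem′ (proj₁ c)))
        where
        lem′ : ∀ c → c ≡ 0ℚ - (0ℚ - c)
        lem′ = solve-∀ ℚ-ring

  tame-bounded : Tame (λ _ → ⊤) (λ K p → proj₁ p ≤ K)
  tame-bounded a b _ = proj₁ a ⊔ proj₁ b , λ K K≥ p p∈ →
    subst (_≤ K) (xForm≡ (proj₁ p) (proj₂ p))
      (≥-on-seg xForm {a} {b} {p} (subst (_≤ K) (sym (xForm≡ (proj₁ a) (proj₂ a))) (≤-trans (p≤p⊔q _ _) K≥))
                      (subst (_≤ K) (sym (xForm≡ (proj₁ b) (proj₂ b))) (≤-trans (p≤q⊔p (proj₁ a) (proj₁ b)) K≥)) p∈)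

  -- Plane drawings, their images and their unions

  open PlaneDrawing

  private variable
    N : ℕ
    H H₁ H₂ : Graph N

  EdgePath : PlaneDrawing {N} H → Fin N → Fin N → Point → Set
  EdgePath d x y = OnPath (pos d x) (bends d x y) (pos d y)

  OnDrawing : PlaneDrawing {N} H → Point → Set
  OnDrawing {H = H} d p =
    (∃ λ w → VS H w ≡ true × p ≡ pos d w) ⊎
    (∃ λ x → ∃ λ y → Adj H x y ≡ true × EdgePath d x y p)

  Adj-vsʳ : ∀ (H : Graph N) u v → Adj H u v ≡ true → VS H v ≡ true
  Adj-vsʳ H u v uv = adj-vs H v u (trans (Adj-sym H v u) uv)

  end∈V : ∀ (H : Graph N) {u v w} → Adj H u v ≡ true → w ≡ u ⊎ w ≡ v → VS H w ≡ true
  end∈V H {u} {v} uv (inj₁ refl) = adj-vs H u v uv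
  end∈V H {u} {v} uv (inj₂ refl) = Adj-vsʳ H u v uv

  tame-drawing : ∀ {Q S} → Tame Q S → (d : PlaneDrawing {N} H) → (∀ p → OnDrawing d p → Q p) →
                 Eventually (λ K → ∀ p → OnDrawing d p → S K p)
  tame-drawing {H = H} {Q} {S} tame d Q-d =
    eventually-map (λ { K (hv , he) p (inj₁ (w , w∈ , refl)) → hv w w∈ ; K (hv , he) p (inj₂ (x , y , xy , p∈)) → he x y xy p p∈ })
      (eventually-and (eventually-fin vertex) (eventually-fin λ x → eventually-fin λ y → edge x y))
    where
    vertex : ∀ w → Eventually (λ K → VS H w ≡ true → S K (pos d w))
    vertex w with VS H w Bool.≟ true
    ... | no w∉ = 0ℚ , λ _ _ w∈ → ⊥-elim (w∉ w∈)
    ... | yes w∈ = eventually-map (λ K h _ → h (pos d w) (seg-start (pos d w) (pos d w)))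
          (tame (pos d w) (pos d w) λ p p∈ → subst Q (sym (seg-point p∈)) (Q-d _ (inj₁ (w , w∈ , refl))))
    edge : ∀ x y → Eventually (λ K → Adj H x y ≡ true → ∀ p → EdgePath d x y p → S K p)
    edge x y with Adj H x y Bool.≟ true
    ... | no xy∉ = 0ℚ , λ _ _ xy → ⊥-elim (xy∉ xy)
    ... | yes xy = eventually-map (λ K h _ → h)
          (tame-path tame _ (bends d x y) _ λ p p∈ → Q-d p (inj₂ (x , y , xy , p∈)))

  module Transfer (d : PlaneDrawing {N} H) (f : Point → Point) (P : Point → Set) (P-d : ∀ p → OnDrawing d p → P p)
                  (f-inj : InjectiveOn P f) (tr : Traces f P) where

    private
      newPath : ∀ x y → Σ (List Point) λ cs → Adj H x y ≡ true → ∀ p → OnPath (f (pos d x)) cs (f (pos d y)) p →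
                ∃ λ q → EdgePath d x y q × p ≡ f q
      newPath x y with Adj H x y Bool.≟ true
      -- The bends of a non-edge are arbitrary and may violate `P`, so a straight path is put in as
      -- a default.
      ... | no xy∉ = [] , λ xy → ⊥-elim (xy∉ xy)
      ... | yes xy = let cs , on-cs = path-image tr (pos d x) (bends d x y) (pos d y) λ p p∈ → P-d p (inj₂ (x , y , xy , p∈))
                     in cs , λ _ → on-cs

      P-vertex : ∀ w → VS H w ≡ true → P (pos d w)
      P-vertex w w∈ = P-d _ (inj₁ (w , w∈ , refl))

      P-edge : ∀ x y → Adj H x y ≡ true → ∀ {q} → EdgePath d x y q → P q
      P-edge x y xy q∈ = P-d _ (inj₂ (x , y , xy , q∈))

    transferred : PlaneDrawing H
    pos     transferred = f ∘ pos d
    bends   transferred x y = proj₁ (newPath x y)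
    pos-inj transferred x y x∈ y∈ eq = pos-inj d x y x∈ y∈ (f-inj _ _ (P-vertex x x∈) (P-vertex y y∈) eq)
    avoid   transferred u v w uv w∈ on =
      let q , q∈ , eq = proj₂ (newPath u v) uv _ on
      in avoid d u v w uv w∈ (subst (EdgePath d u v) (sym (f-inj _ _ (P-vertex w w∈) (P-edge u v uv q∈) eq)) q∈)
    cross   transferred u v x y p uv xy distinct on-uv on-xy =
      let q , q∈ , p≡fq = proj₂ (newPath u v) uv p on-uv
          r , r∈ , p≡fr = proj₂ (newPath x y) xy p on-xy
          q≡r = f-inj q r (P-edge u v uv q∈) (P-edge x y xy r∈) (trans (sym p≡fq) p≡fr)
          w , w-uv , w-xy , q≡w = cross d u v x y q uv xy distinct q∈ (subst (EdgePath d x y) (sym q≡r) r∈)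
      in w , w-uv , w-xy , trans p≡fq (cong f q≡w)

    on-transferred : ∀ p → OnDrawing transferred p → ∃ λ q → OnDrawing d q × p ≡ f q
    on-transferred p (inj₁ (w , w∈ , eq)) = pos d w , inj₁ (w , w∈ , refl) , eq
    on-transferred p (inj₂ (x , y , xy , p∈)) =
      let q , q∈ , eq = proj₂ (newPath x y) xy p p∈ in q , inj₂ (x , y , xy , q∈) , eq

  open Transfer using (transferred; on-transferred)

  subgraph-drawing : (∀ x → VS H₁ x ≡ true → VS H₂ x ≡ true) → (∀ x y → Adj H₁ x y ≡ true → Adj H₂ x y ≡ true) →
                     PlaneDrawing {N} H₂ → PlaneDrawing H₁
  subgraph-drawing V⊆ E⊆ d = record
    { pos     = pos d
    ; bends   = bends d
    ; pos-inj = λ x y x∈ y∈ → pos-inj d x y (V⊆ x x∈) (V⊆ y y∈)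
    ; avoid   = λ u v w uv w∈ → avoid d u v w (E⊆ u v uv) (V⊆ w w∈)
    ; cross   = λ u v x y p uv xy → cross d u v x y p (E⊆ u v uv) (E⊆ x y xy)
    }

  true≢false : ∀ {b} → b ≡ true → b ≡ false → ⊥
  true≢false refl ()

  ∨-true : ∀ {a b} → a ∨ b ≡ true → a ≡ true ⊎ b ≡ true
  ∨-true {true}  _ = inj₁ refl
  ∨-true {false} h = inj₂ h

  module Union {G : Graph N} (union : IsUnion G H₁ H₂) (d₁ : PlaneDrawing H₁) (d₂ : PlaneDrawing H₂)
    (agree : ∀ w → VS H₁ w ≡ true → VS H₂ w ≡ true → pos d₁ w ≡ pos d₂ w)
    (meet : ∀ p → OnDrawing d₁ p → OnDrawing d₂ p → ∃ λ w → VS H₁ w ≡ true × VS H₂ w ≡ true × p ≡ pos d₁ w)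
    where

    private
      pos∪ : Fin N → Point
      pos∪ w with VS H₁ w
      ... | true  = pos d₁ w
      ... | false = pos d₂ w

      bends∪ : Fin N → Fin N → List Point
      bends∪ x y with Adj H₁ x y
      ... | true  = bends d₁ x y
      ... | false = bends d₂ x y

    pos∪₁ : ∀ w → VS H₁ w ≡ true → pos∪ w ≡ pos d₁ w
    pos∪₁ w w∈ with VS H₁ w
    pos∪₁ w refl | true = refl

    pos∪₂ : ∀ w → VS H₂ w ≡ true → pos∪ w ≡ pos d₂ w
    pos∪₂ w w∈ with VS H₁ w in eq
    ... | true  = agree w eq w∈
    ... | false = refl

    private
      vertex : ∀ w → VS G w ≡ true → VS H₁ w ≡ true ⊎ VS H₂ w ≡ true
      vertex w w∈ = ∨-true (trans (sym (proj₁ union w)) w∈)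

      edge : ∀ x y → Adj G x y ≡ true →
             (Adj H₁ x y ≡ true × (∀ p → OnPath (pos∪ x) (bends∪ x y) (pos∪ y) p → EdgePath d₁ x y p)) ⊎
             (Adj H₂ x y ≡ true × (∀ p → OnPath (pos∪ x) (bends∪ x y) (pos∪ y) p → EdgePath d₂ x y p))
      edge x y xy with Adj H₁ x y in eq | ∨-true (trans (sym (proj₂ union x y)) xy)
      ... | true | _ = inj₁ (refl , λ p → subst₂ (λ a b → OnPath a (bends d₁ x y) b p) (pos∪₁ x (adj-vs H₁ x y eq)) (pos∪₁ y (Adj-vsʳ H₁ x y eq)))
      ... | false | inj₁ xy₁ = ⊥-elim (true≢false xy₁ eq)
      ... | false | inj₂ xy₂ = inj₂ (xy₂ , λ p → subst₂ (λ a b → OnPath a (bends d₂ x y) b p) (pos∪₂ x (adj-vs H₂ x y xy₂)) (pos∪₂ y (Adj-vsʳ H₂ x y xy₂)))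

      shared-vertex : ∀ w w′ → VS H₁ w ≡ true → VS H₂ w′ ≡ true → pos∪ w ≡ pos∪ w′ → w ≡ w′
      shared-vertex w w′ w∈₁ w′∈₂ eq =
        let eq₁ = trans (sym (pos∪₁ w w∈₁)) eq
            z , z∈₁ , z∈₂ , at-z = meet (pos d₁ w) (inj₁ (w , w∈₁ , refl)) (inj₁ (w′ , w′∈₂ , trans eq₁ (pos∪₂ w′ w′∈₂)))
        in trans (pos-inj d₁ w z w∈₁ z∈₁ at-z)
                 (sym (pos-inj d₂ w′ z w′∈₂ z∈₂ (trans (sym (trans eq₁ (pos∪₂ w′ w′∈₂))) (trans at-z (agree z z∈₁ z∈₂)))))

      avoid∪ : ∀ u v w → Adj G u v ≡ true → VS G w ≡ true → OnPath (pos∪ u) (bends∪ u v) (pos∪ v) (pos∪ w) → w ≡ u ⊎ w ≡ v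
      avoid∪ u v w uv w∈ on with edge u v uv | vertex w w∈
      ... | inj₁ (uv₁ , on₁) | inj₁ w∈₁ = avoid d₁ u v w uv₁ w∈₁ (subst (EdgePath d₁ u v) (pos∪₁ w w∈₁) (on₁ _ on))
      ... | inj₂ (uv₂ , on₂) | inj₂ w∈₂ = avoid d₂ u v w uv₂ w∈₂ (subst (EdgePath d₂ u v) (pos∪₂ w w∈₂) (on₂ _ on))
      ... | inj₁ (uv₁ , on₁) | inj₂ w∈₂ =
            let z , z∈₁ , z∈₂ , at-z = meet (pos∪ w) (inj₂ (u , v , uv₁ , on₁ _ on)) (inj₁ (w , w∈₂ , pos∪₂ w w∈₂))
                z≡w = shared-vertex z w z∈₁ w∈₂ (trans (pos∪₁ z z∈₁) (sym at-z))
            in subst (λ z → z ≡ u ⊎ z ≡ v) z≡w (avoid d₁ u v z uv₁ z∈₁ (subst (EdgePath d₁ u v) at-z (on₁ _ on)))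
      ... | inj₂ (uv₂ , on₂) | inj₁ w∈₁ =
            let z , z∈₁ , z∈₂ , at-z = meet (pos∪ w) (inj₁ (w , w∈₁ , pos∪₁ w w∈₁)) (inj₂ (u , v , uv₂ , on₂ _ on))
                z≡w = sym (shared-vertex w z w∈₁ z∈₂ (trans at-z (trans (agree z z∈₁ z∈₂) (sym (pos∪₂ z z∈₂)))))
            in subst (λ z → z ≡ u ⊎ z ≡ v) z≡w
                 (avoid d₂ u v z uv₂ z∈₂ (subst (EdgePath d₂ u v) (trans at-z (agree z z∈₁ z∈₂)) (on₂ _ on)))

      cross∪ : ∀ u v x y p → Adj G u v ≡ true → Adj G x y ≡ true → ¬ SameEdge u v x y →
               OnPath (pos∪ u) (bends∪ u v) (pos∪ v) p → OnPath (pos∪ x) (bends∪ x y) (pos∪ y) p →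
               ∃ λ w → (w ≡ u ⊎ w ≡ v) × (w ≡ x ⊎ w ≡ y) × (p ≡ pos∪ w)
      cross∪ u v x y p uv xy distinct on-uv on-xy with edge u v uv | edge x y xy
      ... | inj₁ (uv₁ , on₁) | inj₁ (xy₁ , on₁′) =
            let w , w-uv , w-xy , eq = cross d₁ u v x y p uv₁ xy₁ distinct (on₁ p on-uv) (on₁′ p on-xy)
            in w , w-uv , w-xy , trans eq (sym (pos∪₁ w (end∈V H₁ uv₁ w-uv)))
      ... | inj₂ (uv₂ , on₂) | inj₂ (xy₂ , on₂′) =
            let w , w-uv , w-xy , eq = cross d₂ u v x y p uv₂ xy₂ distinct (on₂ p on-uv) (on₂′ p on-xy)
            in w , w-uv , w-xy , trans eq (sym (pos∪₂ w (end∈V H₂ uv₂ w-uv)))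
      -- Edges from different drawings meet only at a shared vertex, by `meet`; `avoid` in each
      -- drawing then makes this vertex an end of either edge.
      ... | inj₁ (uv₁ , on₁) | inj₂ (xy₂ , on₂) =
            let z , z∈₁ , z∈₂ , at-z = meet p (inj₂ (u , v , uv₁ , on₁ p on-uv)) (inj₂ (x , y , xy₂ , on₂ p on-xy))
            in z , avoid d₁ u v z uv₁ z∈₁ (subst (EdgePath d₁ u v) at-z (on₁ p on-uv))
                 , avoid d₂ x y z xy₂ z∈₂ (subst (EdgePath d₂ x y) (trans at-z (agree z z∈₁ z∈₂)) (on₂ p on-xy))
                 , trans at-z (sym (pos∪₁ z z∈₁))
      ... | inj₂ (uv₂ , on₂) | inj₁ (xy₁ , on₁) =
            let z , z∈₁ , z∈₂ , at-z = meet p (inj₂ (x , y , xy₁ , on₁ p on-xy)) (inj₂ (u , v , uv₂ , on₂ p on-uv))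
            in z , avoid d₂ u v z uv₂ z∈₂ (subst (EdgePath d₂ u v) (trans at-z (agree z z∈₁ z∈₂)) (on₂ p on-uv))
                 , avoid d₁ x y z xy₁ z∈₁ (subst (EdgePath d₁ x y) at-z (on₁ p on-xy))
                 , trans at-z (sym (pos∪₁ z z∈₁))

      inj∪ : ∀ x y → VS G x ≡ true → VS G y ≡ true → pos∪ x ≡ pos∪ y → x ≡ y
      inj∪ x y x∈ y∈ eq with vertex x x∈ | vertex y y∈
      ... | inj₁ x∈₁ | inj₁ y∈₁ = pos-inj d₁ x y x∈₁ y∈₁ (trans (sym (pos∪₁ x x∈₁)) (trans eq (pos∪₁ y y∈₁)))
      ... | inj₂ x∈₂ | inj₂ y∈₂ = pos-inj d₂ x y x∈₂ y∈₂ (trans (sym (pos∪₂ x x∈₂)) (trans eq (pos∪₂ y y∈₂)))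
      ... | inj₁ x∈₁ | inj₂ y∈₂ = shared-vertex x y x∈₁ y∈₂ eq
      ... | inj₂ x∈₂ | inj₁ y∈₁ = sym (shared-vertex y x y∈₁ x∈₂ (sym eq))

    union-drawing : PlaneDrawing G
    union-drawing = record { pos = pos∪ ; bends = bends∪ ; pos-inj = inj∪ ; avoid = avoid∪ ; cross = cross∪ }

    on-union : ∀ p → OnDrawing union-drawing p → OnDrawing d₁ p ⊎ OnDrawing d₂ p
    on-union p (inj₁ (w , w∈ , eq)) =
      ⊎-map (λ w∈₁ → inj₁ (w , w∈₁ , trans eq (pos∪₁ w w∈₁))) (λ w∈₂ → inj₁ (w , w∈₂ , trans eq (pos∪₂ w w∈₂))) (vertex w w∈)
    on-union p (inj₂ (x , y , xy , p∈)) =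
      ⊎-map (λ (xy₁ , on₁) → inj₂ (x , y , xy₁ , on₁ p p∈)) (λ (xy₂ , on₂) → inj₂ (x , y , xy₂ , on₂ p p∈)) (edge x y xy)

  open Union using (union-drawing; on-union; pos∪₁; pos∪₂)

  -- Affine changes of coordinates

  record Affinity : Set where
    field
      fun : Point → Point
      inj : ∀ p q → fun p ≡ fun q → p ≡ q
      seg : ∀ a b p → OnSeg (fun a) (fun b) p → ∃ λ q → OnSeg a b q × p ≡ fun q

    path : ∀ a cs b p → OnPath (fun a) (map fun cs) (fun b) p → ∃ λ q → OnPath a cs b q × p ≡ fun q
    path a []       b p h = seg a b p h
    path a (c ∷ cs) b p (inj₁ h) = let q , q∈ , eq = seg a c p h in q , inj₁ q∈ , eq
    path a (c ∷ cs) b p (inj₂ h) = let q , q∈ , eq = path c cs b p h in q , inj₂ q∈ , eq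

    module _ {N} {H : Graph N} (d : PlaneDrawing H) where
      moved : PlaneDrawing H
      moved = transferred d fun (λ _ → ⊤) (λ _ _ → tt) (λ p q _ _ → inj p q) (λ a b _ → [] , seg a b)

      on-moved : ∀ p → OnDrawing moved p → ∃ λ q → OnDrawing d q × p ≡ fun q
      on-moved = on-transferred d fun (λ _ → ⊤) (λ _ _ → tt) (λ p q _ _ → inj p q) (λ a b _ → [] , seg a b)

  open Affinity

  affinity : ∀ (f : Point → Point) L M → (∀ p → proj₁ (f p) ≡ ⟦ L ⟧ p) → (∀ p → proj₂ (f p) ≡ ⟦ M ⟧ p) →
             (∀ p q → f p ≡ f q → p ≡ q) → Affinity
  affinity f L M eq₁ eq₂ f-inj = record
    { fun = f
    ; inj = f-inj
    ; seg = λ a b → proj₂ (traces-affine {f} {λ _ → ⊤} L M (λ p _ → eq₁ p , eq₂ p) a b (λ _ _ → tt))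
    }

  stretchˣ : ∀ k → 0ℚ < k → Affinity
  stretchˣ k 0<k = affinity (λ p → k * proj₁ p - 1ℚ , proj₂ p) (form k 0ℚ (- 1ℚ)) yForm
    (λ (x , y) → lem k x y) (λ (x , y) → sym (yForm≡ x y))
    (λ p q eq → cong₂ _,_ (≡-by (*-cancelˡ-0 (0<⇒≢0 0<k)
      (trans (lem′ k (proj₁ p) (proj₁ q)) (drop-eq 0ℚ (- 1ℚ) (cong proj₁ eq))))) (cong proj₂ eq))
    where
    lem : ∀ k x y → k * x - 1ℚ ≡ k * x + 0ℚ * y + - 1ℚ
    lem = solve-∀ ℚ-ring
    lem′ : ∀ k x x′ → k * (x′ - x) ≡ 0ℚ + - 1ℚ * (k * x - 1ℚ - (k * x′ - 1ℚ))
    lem′ = solve-∀ ℚ-ring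

  stretchʸ : ∀ K → 0ℚ < K → Affinity
  stretchʸ K 0<K = affinity (λ p → proj₁ p , K * proj₂ p) xForm (form 0ℚ K 0ℚ)
    (λ (x , y) → sym (xForm≡ x y)) (λ (x , y) → lem K x y)
    (λ p q eq → cong₂ _,_ (cong proj₁ eq) (≡-by (*-cancelˡ-0 (0<⇒≢0 0<K)
      (trans (lem′ K (proj₂ p) (proj₂ q)) (drop-eq 0ℚ (- 1ℚ) (cong proj₂ eq))))))
    where
    lem : ∀ K x y → K * y ≡ 0ℚ * x + K * y + 0ℚ
    lem = solve-∀ ℚ-ring
    lem′ : ∀ K y y′ → K * (y′ - y) ≡ 0ℚ + - 1ℚ * (K * y - K * y′)
    lem′ = solve-∀ ℚ-ring

  0<sq : ∀ {p} → p ≢ 0ℚ → 0ℚ < p * p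
  0<sq {p} p≢0 = ≤∧≢⇒< (0≤sq p) λ eq → p≢0 (*-cancelˡ-0 p≢0 (sym eq))

  -- The similarity sending U to (α, 0) and V to (β, 0), followed by a rescaling of the second coordinate.
  module ToAxis (U V : Point) (U≢V : U ≢ V) (α β : ℚ) (α≢β : α ≢ β) where
    private
      u₁ = proj₁ U
      u₂ = proj₂ U
      e₁ = proj₁ V - u₁
      e₂ = proj₂ V - u₂
      γ = β - α

      0<n : 0ℚ < e₁ * e₁ + e₂ * e₂
      0<n with e₁ ≟ 0ℚ | e₂ ≟ 0ℚ
      ... | yes e₁≡0 | yes e₂≡0 = ⊥-elim (U≢V (cong₂ _,_ (≡-by e₁≡0) (≡-by e₂≡0)))
      ... | no e₁≢0  | _        = 0<+≤ (0<sq e₁≢0) (0≤sq e₂)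
      ... | yes _    | no e₂≢0  = subst (0ℚ <_) (+-comm (e₂ * e₂) (e₁ * e₁)) (0<+≤ (0<sq e₂≢0) (0≤sq e₁))

      inverse = invert (0<⇒≢0 0<n)
      k = proj₁ inverse
      inv = proj₂ inverse

      f : Point → Point
      -- With e = V - U, the dot product over the squared length is the parameter along UV, and the
      -- cross product measures the offset from that line. Leaving the offset unnormalised avoids a
      -- square root.
      f (x , y) = α + γ * k * (e₁ * (x - u₁) + e₂ * (y - u₂)) , e₁ * (y - u₂) - e₂ * (x - u₁)

      γ≢0 : γ ≢ 0ℚ
      γ≢0 = α≢β ∘ ≡-by

      f-inj : ∀ p q → f p ≡ f q → p ≡ q
      f-inj (x , y) (x′ , y′) eq = cong₂ _,_
        (≡-by (*-cancelˡ-0 γ≢0 (trans (lem₁ α γ k e₁ e₂ u₁ u₂ x y x′ y′) (trans (drop-eq _ (γ * k * e₂) (cong proj₂ eq))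
          (trans (drop-eq _ (- e₁) (cong proj₁ eq)) (drop-eq 0ℚ (γ * (x - x′)) inv))))))
        (≡-by (*-cancelˡ-0 γ≢0 (trans (lem₂ α γ k e₁ e₂ u₁ u₂ x y x′ y′) (trans (drop-eq _ (- (γ * k * e₁)) (cong proj₂ eq))
          (trans (drop-eq _ (- e₂) (cong proj₁ eq)) (drop-eq 0ℚ (γ * (y - y′)) inv))))))
        where
        lem₁ : ∀ α γ k e₁ e₂ u₁ u₂ x y x′ y′ → γ * (x′ - x) ≡
          0ℚ + γ * (x - x′) * ((e₁ * e₁ + e₂ * e₂) * k - 1ℚ)
          + - e₁ * (α + γ * k * (e₁ * (x - u₁) + e₂ * (y - u₂)) - (α + γ * k * (e₁ * (x′ - u₁) + e₂ * (y′ - u₂))))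
          + γ * k * e₂ * (e₁ * (y - u₂) - e₂ * (x - u₁) - (e₁ * (y′ - u₂) - e₂ * (x′ - u₁)))
        lem₁ = solve-∀ ℚ-ring
        lem₂ : ∀ α γ k e₁ e₂ u₁ u₂ x y x′ y′ → γ * (y′ - y) ≡
          0ℚ + γ * (y - y′) * ((e₁ * e₁ + e₂ * e₂) * k - 1ℚ)
          + - e₂ * (α + γ * k * (e₁ * (x - u₁) + e₂ * (y - u₂)) - (α + γ * k * (e₁ * (x′ - u₁) + e₂ * (y′ - u₂))))
          + - (γ * k * e₁) * (e₁ * (y - u₂) - e₂ * (x - u₁) - (e₁ * (y′ - u₂) - e₂ * (x′ - u₁)))
        lem₂ = solve-∀ ℚ-ring

    toAxis : Affinity
    toAxis = affinity f
      (form (γ * k * e₁) (γ * k * e₂) (α - γ * k * (e₁ * u₁ + e₂ * u₂))) (form (- e₂) e₁ (e₂ * u₁ - e₁ * u₂))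
      (λ (x , y) → lem₁ α γ k e₁ e₂ u₁ u₂ x y) (λ (x , y) → lem₂ e₁ e₂ u₁ u₂ x y) f-inj
      where
      lem₁ : ∀ α γ k e₁ e₂ u₁ u₂ x y → α + γ * k * (e₁ * (x - u₁) + e₂ * (y - u₂)) ≡
             γ * k * e₁ * x + γ * k * e₂ * y + (α - γ * k * (e₁ * u₁ + e₂ * u₂))
      lem₁ = solve-∀ ℚ-ring
      lem₂ : ∀ e₁ e₂ u₁ u₂ x y → e₁ * (y - u₂) - e₂ * (x - u₁) ≡ - e₂ * x + e₁ * y + (e₂ * u₁ - e₁ * u₂)
      lem₂ = solve-∀ ℚ-ring

    toAxis-start : fun toAxis U ≡ (α , 0ℚ)
    toAxis-start = cong₂ _,_ (lem₁ α γ k e₁ e₂ u₁ u₂) (lem₂ e₁ e₂ u₁ u₂)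
      where
      lem₁ : ∀ α γ k e₁ e₂ u₁ u₂ → α + γ * k * (e₁ * (u₁ - u₁) + e₂ * (u₂ - u₂)) ≡ α
      lem₁ = solve-∀ ℚ-ring
      lem₂ : ∀ e₁ e₂ u₁ u₂ → e₁ * (u₂ - u₂) - e₂ * (u₁ - u₁) ≡ 0ℚ
      lem₂ = solve-∀ ℚ-ring

    toAxis-end : fun toAxis V ≡ (β , 0ℚ)
    toAxis-end = cong₂ _,_ (trans (lem₁ α β k e₁ e₂) (drop-eq β (β - α) inv)) (lem₂ e₁ e₂)
      where
      lem₁ : ∀ α β k e₁ e₂ → α + (β - α) * k * (e₁ * e₁ + e₂ * e₂) ≡ β + (β - α) * ((e₁ * e₁ + e₂ * e₂) * k - 1ℚ)
      lem₁ = solve-∀ ℚ-ring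
      lem₂ : ∀ e₁ e₂ → e₁ * e₂ - e₂ * e₁ ≡ 0ℚ
      lem₂ = solve-∀ ℚ-ring

  open ToAxis using (toAxis; toAxis-start; toAxis-end)

  -- Segments and kites on the axis

  seg-axis : ∀ l r p → l < r → proj₂ p ≡ 0ℚ → l ≤ proj₁ p → proj₁ p ≤ r → OnSeg (l , 0ℚ) (r , 0ℚ) p
  seg-axis l r p l<r y≡0 l≤x x≤r =
    let i , 0<i , inv = invert⁺ (0<-from-< l<r) in
    (proj₁ p - l) * i , 0≤* (0≤-from-≤ l≤x) (<⇒≤ 0<i) ,
    ≤-by (0≤* (0≤-from-≤ x≤r) (<⇒≤ 0<i)) (trans (high l r (proj₁ p) i) (drop-eq _ (- 1ℚ) inv)) ,
    cong₂ _,_ (sym (trans (coord l r (proj₁ p) i) (drop-eq _ (proj₁ p - l) inv))) (trans y≡0 (flat ((proj₁ p - l) * i)))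
    where
    high : ∀ l r x i → 1ℚ - (x - l) * i ≡ (r - x) * i + - 1ℚ * ((r - l) * i - 1ℚ)
    high = solve-∀ ℚ-ring
    coord : ∀ l r x i → l + (x - l) * i * (r - l) ≡ x + (x - l) * ((r - l) * i - 1ℚ)
    coord = solve-∀ ℚ-ring
    flat : ∀ t → 0ℚ ≡ 0ℚ + t * (0ℚ - 0ℚ)
    flat = solve-∀ ℚ-ring

  kite-axis : ∀ l r {p} → proj₂ p ≡ 0ℚ → Kite l r p → l ≤ proj₁ p × proj₁ p ≤ r
  kite-axis l r {x , _} refl (lo , hi) = subst (_≤ x) (*-identityʳ l) lo , subst (x ≤_) (*-identityʳ r) hi

  axis-kite : ∀ l r {p} → proj₂ p ≡ 0ℚ → l ≤ proj₁ p → proj₁ p ≤ r → Kite l r p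
  axis-kite l r {x , _} refl lo hi = subst (_≤ x) (sym (*-identityʳ l)) lo , subst (x ≤_) (sym (*-identityʳ r)) hi

  ball-kite : ∀ p → ‖ p ‖ ≤ 1ℚ → Kite (- 1ℚ) 1ℚ p
  ball-kite (x , y) ≤1 =
    ≤-by (0≤+ (0≤-from-≤ ≤1) (0≤-from-≤ (-p≤∣p∣ x))) (low x ∣ x ∣ ∣ y ∣) ,
    ≤-by (0≤+ (0≤-from-≤ ≤1) (0≤-from-≤ (p≤∣p∣ x))) (high x ∣ x ∣ ∣ y ∣)
    where
    low : ∀ x a b → x - - 1ℚ * (1ℚ - b) ≡ 1ℚ - (a + b) + (a - - x)
    low = solve-∀ ℚ-ring
    high : ∀ x a b → 1ℚ * (1ℚ - b) - x ≡ 1ℚ - (a + b) + (a - x)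
    high = solve-∀ ℚ-ring

  either-side : ∀ l r x → ¬ (l < x × x < r) → x ≤ l ⊎ r ≤ x
  either-side l r x h with x ≤? l | r ≤? x
  ... | yes x≤l | _       = inj₁ x≤l
  ... | no _    | yes r≤x = inj₂ r≤x
  ... | no x≰l  | no r≰x  = ⊥-elim (h (≰⇒> x≰l , ≰⇒> r≰x))

  -1<1 : - 1ℚ < 1ℚ
  -1<1 = <-trans (negative⁻¹ (- 1ℚ)) 0<1

  -- If [c, e] turns back into [origin, c] at c = (1, 0), then the detour through c can be cut off.
  cut-corner : ∀ e p → OnSeg (1ℚ , 0ℚ) e p → OnSeg origin (1ℚ , 0ℚ) p → p ≢ (1ℚ , 0ℚ) →
               ∀ q → OnSeg origin e q → OnSeg origin (1ℚ , 0ℚ) q ⊎ OnSeg (1ℚ , 0ℚ) e q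
  cut-corner e@(z , z′) p (t , 0≤t , t≤1 , refl) (s , 0≤s , s≤1 , p≡) p≢c (._ , ._) (τ , 0≤τ , τ≤1 , refl) =
    -- The overlap forces e onto the axis with z < 1. For z ≥ 0 the segment [origin, e] lies in
    -- [origin, c], for z ≤ 0 in [e, c].
    [ (λ 0≤z → inj₁ (seg-axis 0ℚ 1ℚ q 0<1 qy (subst (0ℚ ≤_) (sym qx) (0≤* 0≤τ 0≤z)) (subst (_≤ 1ℚ) (sym qx) τz≤1)))
    , (λ z≤0 → inj₂ (subst (λ w → OnSeg (1ℚ , 0ℚ) (z , w) q) (sym z′≡0)
                   (seg-rev (z , 0ℚ) (1ℚ , 0ℚ) (seg-axis z 1ℚ q z<1 qy
                     (subst (z ≤_) (sym qx) (≤-by (0≤* (0≤-from-≤ τ≤1) (0≤-from-≤ z≤0)) (low z τ)))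
                     (subst (_≤ 1ℚ) (sym qx) τz≤1)))))
    ]′ (≤-total 0ℚ z)
    where
    q : Point
    q = 0ℚ + τ * (z - 0ℚ) , 0ℚ + τ * (z′ - 0ℚ)
    px : 1ℚ + t * (z - 1ℚ) ≡ s
    px = trans (cong proj₁ p≡) (lem s)
      where
      lem : ∀ s → 0ℚ + s * (1ℚ - 0ℚ) ≡ s
      lem = solve-∀ ℚ-ring
    py : t * z′ ≡ 0ℚ
    py = trans (lem t z′) (trans (cong proj₂ p≡) (lem′ s))
      where
      lem : ∀ t z → t * z ≡ 0ℚ + t * (z - 0ℚ)
      lem = solve-∀ ℚ-ring
      lem′ : ∀ s → 0ℚ + s * (0ℚ - 0ℚ) ≡ 0ℚ
      lem′ = solve-∀ ℚ-ring
    s≢1 : s ≢ 1ℚ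
    s≢1 refl = p≢c p≡
    t≢0 : t ≢ 0ℚ
    t≢0 refl = s≢1 (trans (sym px) (lem z))
      where
      lem : ∀ z → 1ℚ + 0ℚ * (z - 1ℚ) ≡ 1ℚ
      lem = solve-∀ ℚ-ring
    z′≡0 : z′ ≡ 0ℚ
    z′≡0 = *-cancelˡ-0 t≢0 py
    z<1 : z < 1ℚ
    z<1 with 1ℚ ≤? z
    ... | no 1≰z = ≰⇒> 1≰z
    ... | yes 1≤z = ⊥-elim (s≢1 (≤-antisym s≤1 (subst (1ℚ ≤_) px (≤-by (0≤* 0≤t (0≤-from-≤ 1≤z)) (lem t z)))))
      where
      lem : ∀ t z → 1ℚ + t * (z - 1ℚ) - 1ℚ ≡ t * (z - 1ℚ)
      lem = solve-∀ ℚ-ring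
    qx : proj₁ q ≡ τ * z
    qx = lem τ z
      where
      lem : ∀ t z → 0ℚ + t * (z - 0ℚ) ≡ t * z
      lem = solve-∀ ℚ-ring
    qy : proj₂ q ≡ 0ℚ
    qy = trans (cong (λ w → 0ℚ + τ * (w - 0ℚ)) z′≡0) (lem τ)
      where
      lem : ∀ t → 0ℚ + t * (0ℚ - 0ℚ) ≡ 0ℚ
      lem = solve-∀ ℚ-ring
    τz≤1 : τ * z ≤ 1ℚ
    τz≤1 = ≤-by (0≤+ (0≤-from-≤ τ≤1) (0≤* 0≤τ (<⇒≤ (0<-from-< z<1)))) (lem τ z)
      where
      lem : ∀ t z → 1ℚ - t * z ≡ 1ℚ - t + t * (1ℚ - z)
      lem = solve-∀ ℚ-ring
    low : ∀ z τ → τ * z - z ≡ (1ℚ - τ) * (0ℚ - z)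
    low = solve-∀ ℚ-ring

  _≟ₚ_ : DecidableEquality Point
  _≟ₚ_ = ≡-dec _≟_ _≟_

  kite? : ∀ l r p → Dec (Kite l r p)
  kite? l r p = (l * height p ≤? proj₁ p) ×-dec (proj₁ p ≤? r * height p)

  -- Straightening a free curve

  module Straighten {N} (H : Graph N) (u v : Fin N) (u∈ : VS H u ≡ true) (v∈ : VS H v ≡ true) (u≢v : u ≢ v) where

    -- The curve stands for e while `H` is a graph from which e has been deleted. Kept apart from
    -- the drawing, it can be rerouted without touching the other edges, and it may meet itself.
    FreePath : PlaneDrawing H → List Point → Set
    FreePath d cs = ∀ p → OnDrawing d p → OnPath (pos d u) cs (pos d v) p → p ≡ pos d u ⊎ p ≡ pos d v

    JoinedBy : ℕ → Set
    JoinedBy n = ∃ λ d → ∃ λ cs → FreePath d cs × length cs ℕ.≤ n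

    free-moved : ∀ A d cs → FreePath d cs → FreePath (moved A d) (map (fun A) cs)
    free-moved A d cs free p p∈D p∈path =
      let q , q∈D , p≡fq = on-moved A d p p∈D
          r , r∈path , p≡fr = path A (pos d u) cs (pos d v) p p∈path
          q≡r = inj A q r (trans (sym p≡fq) p≡fr)
      in ⊎-map (trans p≡fq ∘ cong (fun A)) (trans p≡fq ∘ cong (fun A))
           (free q q∈D (subst (OnPath (pos d u) cs (pos d v)) (sym q≡r) r∈path))

    -- Under the assumption that n bends never suffice, every simplification is a contradiction. In
    -- this way minimality is exploited without a minimum having to be found.
    module DragStep (n : ℕ) (¬shorter : ¬ JoinedBy n) (d : PlaneDrawing H) (cs : List Point) (cs≤n : length cs ℕ.≤ n)
      (at-u : pos d u ≡ origin) (free : FreePath d ((1ℚ , 0ℚ) ∷ cs)) where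

      c V : Point
      c = 1ℚ , 0ℚ
      V = pos d v

      free′ : ∀ p → OnDrawing d p → OnPath origin (c ∷ cs) V p → p ≡ origin ⊎ p ≡ V
      free′ p p∈D p∈path = subst (λ U → p ≡ U ⊎ p ≡ V) at-u
        (free p p∈D (subst (λ U → OnPath U (c ∷ cs) V p) (sym at-u) p∈path))

      shortcut : ∀ ds → length ds ℕ.≤ n → (∀ p → OnPath origin ds V p → OnPath origin (c ∷ cs) V p) → ⊥
      shortcut ds ds≤n sub = ¬shorter (d , ds , (λ p p∈D p∈path →
        subst (λ U → p ≡ U ⊎ p ≡ V) (sym at-u) (free′ p p∈D (sub p (subst (λ U → OnPath U ds V p) at-u p∈path)))) , ds≤n)

      V∉segment : ¬ OnSeg origin c V
      V∉segment V∈ = shortcut [] z≤n λ p p∈ → inj₁ (seg-prefix origin c V∈ p∈)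

      drawing∩segment : ∀ p → OnDrawing d p → OnSeg origin c p → p ≡ origin
      drawing∩segment p p∈D p∈seg = [ id , (λ p≡V → ⊥-elim (V∉segment (subst (OnSeg origin c) p≡V p∈seg))) ]′
        (free′ p p∈D (inj₁ p∈seg))

      -- A return to the first segment at p ≠ c would save a bend. If the next segment turns back at
      -- c, its corner is cut off; if the return happens later, the curve can jump ahead from p.
      rest∩segment : ∀ p → OnPath c cs V p → OnSeg origin c p → p ≡ c
      rest∩segment p p∈rest p∈seg with p ≟ₚ c
      ... | yes p≡c = p≡c
      ... | no p≢c  = ⊥-elim (go cs refl p∈rest)
        where
        go : ∀ cs′ → cs ≡ cs′ → OnPath c cs′ V p → ⊥
        go [] refl p∈cV = shortcut [] z≤n λ q → cut-corner V p p∈cV p∈seg p≢c q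
        go (c₂ ∷ cs₂) refl (inj₁ p∈cc₂) = shortcut (c₂ ∷ cs₂) cs≤n
          λ q → [ (λ q∈ → ⊎-map id inj₁ (cut-corner c₂ p p∈cc₂ p∈seg p≢c q q∈)) , inj₂ ∘ inj₂ ]′
        go (c₂ ∷ cs₂) refl (inj₂ p∈) =
          let ds , ds≤ , sub = path-from c₂ cs₂ V p∈ in
          -- The bend at c is replaced by one at p, and the detour between c and the later visit of
          -- p disappears together with the bend `c₂`.
          shortcut (p ∷ ds) (ℕₚ.≤-trans (s≤s ds≤) cs≤n) λ q → ⊎-map (seg-prefix origin c p∈seg) (inj₂ ∘ sub q)

      origin∉rest : ∀ p → OnPath c cs V p → p ≢ origin
      origin∉rest p p∈rest refl = <⇒≢ 0<1 (cong proj₁ (rest∩segment origin p∈rest (seg-start origin c)))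

      private
        behind = tame-path tame-behind c cs V origin∉rest

      k r : ℚ
      -- The stretch takes [0, 1] on the axis to [-1, k - 1]. The first bound keeps the rest of the
      -- curve off [-2, -1] on the axis, the second ensures r ≥ 1.
      k = proj₁ behind ⊔ 2ℚ
      r = k - 1ℚ

      0<r : 0ℚ < r
      0<r = <-by (0<+≤ 0<1 (0≤-from-≤ (p≤q⊔p (proj₁ behind) 2ℚ))) (lem k)
        where
        lem : ∀ k → k - 1ℚ - 0ℚ ≡ 1ℚ + (k - 2ℚ)
        lem = solve-∀ ℚ-ring

      0<k : 0ℚ < k
      0<k = <-≤-trans (positive⁻¹ 2ℚ) (p≤q⊔p (proj₁ behind) 2ℚ)

      A : Affinity
      A = stretchˣ k 0<k

      d₂ : PlaneDrawing H
      d₂ = moved A d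

      cs₂ : List Point
      cs₂ = map (fun A) cs

      rc tip : Point
      rc = r , 0ℚ
      tip = - 1ℚ , 0ℚ

      fun-c : fun A c ≡ rc
      fun-c = cong (_, 0ℚ) (lem k)
        where
        lem : ∀ k → k * 1ℚ - 1ℚ ≡ k - 1ℚ
        lem = solve-∀ ℚ-ring

      fun-origin : fun A origin ≡ tip
      fun-origin = cong (_, 0ℚ) (lem k)
        where
        lem : ∀ k → k * 0ℚ - 1ℚ ≡ - 1ℚ
        lem = solve-∀ ℚ-ring

      unstretch-≥0 : ∀ x → - 1ℚ ≤ k * x - 1ℚ → 0ℚ ≤ x
      unstretch-≥0 x h = 0≤-cancelˡ 0<k (≤-by (0≤-from-≤ h) (lem k x))
        where
        lem : ∀ k x → k * x - 0ℚ ≡ k * x - 1ℚ - - 1ℚ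
        lem = solve-∀ ℚ-ring

      unstretch-≤1 : ∀ x → k * x - 1ℚ ≤ r → x ≤ 1ℚ
      unstretch-≤1 x h = ≤-by (0≤-cancelˡ 0<k (≤-by (0≤-from-≤ h) (lem k x))) refl
        where
        lem : ∀ k x → k * (1ℚ - x) - 0ℚ ≡ k - 1ℚ - (k * x - 1ℚ)
        lem = solve-∀ ℚ-ring

      unstretch-≥-1 : ∀ x → - 2ℚ ≤ k * x - 1ℚ → - 1ℚ ≤ k * x
      unstretch-≥-1 x h = ≤-by (0≤-from-≤ h) (lem k x)
        where
        lem : ∀ k x → k * x - - 1ℚ ≡ k * x - 1ℚ - - 2ℚ
        lem = solve-∀ ℚ-ring

      drawing₂-axis : ∀ p → OnDrawing d₂ p → proj₂ p ≡ 0ℚ → - 1ℚ ≤ proj₁ p → proj₁ p ≤ r → p ≡ tip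
      drawing₂-axis p p∈ y≡0 -1≤x x≤r =
        let q , q∈ , p≡ = on-moved A d p p∈ in
        trans p≡ (trans (cong (fun A) (drawing∩segment q q∈
          (seg-axis 0ℚ 1ℚ q 0<1 (trans (sym (cong proj₂ p≡)) y≡0)
            (unstretch-≥0 (proj₁ q) (subst (- 1ℚ ≤_) (cong proj₁ p≡) -1≤x))
            (unstretch-≤1 (proj₁ q) (subst (_≤ r) (cong proj₁ p≡) x≤r))))) fun-origin)

      rest₂-axis : ∀ p → OnPath rc cs₂ (pos d₂ v) p → proj₂ p ≡ 0ℚ → - 2ℚ ≤ proj₁ p → proj₁ p ≤ r → p ≡ rc
      rest₂-axis p p∈ y≡0 -2≤x x≤r =
        let q , q∈ , p≡ = path A c cs V p (subst (λ a → OnPath a cs₂ (pos d₂ v) p) (sym fun-c) p∈)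
            y≡0′ = trans (sym (cong proj₂ p≡)) y≡0
        in trans p≡ (trans (cong (fun A) (rest∩segment q q∈ (seg-axis 0ℚ 1ℚ q 0<1 y≡0′
              (<⇒≤ (proj₂ behind k (p≤p⊔q (proj₁ behind) 2ℚ) q q∈ y≡0′
                (unstretch-≥-1 (proj₁ q) (subst (- 2ℚ ≤_) (cong proj₁ p≡) -2≤x))))
              (unstretch-≤1 (proj₁ q) (subst (_≤ r) (cong proj₁ p≡) x≤r))))) fun-c)

      private
        -- The drawing has to avoid only the kite over [-1, r], through which u will travel. The
        -- rest of the curve must avoid the wider kite over [-2, r], where all moved points land.
        thin-drawing = tame-drawing (tame-thin (- 1ℚ) r (negative⁻¹ (- 1ℚ)) 0<r) d₂
          λ p p∈ y≡0 → either-side (- 1ℚ) r (proj₁ p) λ (lo , hi) →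
            <-irrefl (sym (cong proj₁ (drawing₂-axis p p∈ y≡0 (<⇒≤ lo) (<⇒≤ hi)))) lo
        thin-rest = tame-path (tame-thin (- 2ℚ) r (negative⁻¹ (- 2ℚ)) 0<r) rc cs₂ (pos d₂ v)
          λ p p∈ y≡0 → either-side (- 2ℚ) r (proj₁ p) λ (lo , hi) →
            <-irrefl (cong proj₁ (rest₂-axis p p∈ y≡0 (<⇒≤ lo) (<⇒≤ hi))) hi
        thin = eventually-and thin-drawing thin-rest

      K : ℚ
      K = proj₁ thin ⊔ 1ℚ

      0<K : 0ℚ < K
      0<K = <-≤-trans 0<1 (p≤q⊔p (proj₁ thin) 1ℚ)

      B : Affinity
      B = stretchʸ K 0<K

      d₃ : PlaneDrawing H
      d₃ = moved B d₂

      cs₃ : List Point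
      cs₃ = map (fun B) cs₂

      fun-axis : ∀ x → fun B (x , 0ℚ) ≡ (x , 0ℚ)
      fun-axis x = cong (x ,_) (*-zeroʳ K)

      drawing₃∩kite : ∀ p → OnDrawing d₃ p → Kite (- 1ℚ) r p → p ≡ tip
      drawing₃∩kite p p∈ in-kite =
        let q , q∈ , p≡ = on-moved B d₂ p p∈
            in-kite′ = subst (Kite (- 1ℚ) r) p≡ in-kite
            y≡0 = proj₁ (proj₂ thin K (p≤p⊔q (proj₁ thin) 1ℚ)) q q∈ in-kite′
            lo , hi = kite-axis (- 1ℚ) r {fun B q} (trans (cong (K *_) y≡0) (*-zeroʳ K)) in-kite′
        in trans p≡ (trans (cong (fun B) (drawing₂-axis q q∈ y≡0 lo hi)) (fun-axis (- 1ℚ)))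

      rest₃∩kite : ∀ p → OnPath rc cs₃ (pos d₃ v) p → Kite (- 2ℚ) r p → p ≡ rc
      rest₃∩kite p p∈ in-kite =
        let q , q∈ , p≡ = path B rc cs₂ (pos d₂ v) p (subst (λ a → OnPath a cs₃ (pos d₃ v) p) (sym (fun-axis r)) p∈)
            in-kite′ = subst (Kite (- 2ℚ) r) p≡ in-kite
            y≡0 = proj₂ (proj₂ thin K (p≤p⊔q (proj₁ thin) 1ℚ)) q q∈ in-kite′
            lo , hi = kite-axis (- 2ℚ) r {fun B q} (trans (cong (K *_) y≡0) (*-zeroʳ K)) in-kite′
        in trans p≡ (trans (cong (fun B) (rest₂-axis q q∈ y≡0 lo hi)) (fun-axis r))

      at-u₃ : pos d₃ u ≡ tip
      at-u₃ = trans (cong (fun B ∘ fun A) at-u) (trans (cong (fun B) fun-origin) (fun-axis (- 1ℚ)))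

      free₃ : ∀ p → OnDrawing d₃ p → OnPath rc cs₃ (pos d₃ v) p → p ≡ tip ⊎ p ≡ pos d₃ v
      free₃ p p∈D p∈rest = subst (λ U → p ≡ U ⊎ p ≡ pos d₃ v) at-u₃
        (free-moved B d₂ (fun A c ∷ cs₂) (free-moved A d (c ∷ cs) free) p p∈D
          (inj₂ (subst (λ a → OnPath a cs₃ (pos d₃ v) p) (sym (trans (cong (fun B) fun-c) (fun-axis r))) p∈rest)))

      V₃≢rc : pos d₃ v ≢ rc
      V₃≢rc eq = V∉segment (subst (OnSeg origin c)
        (sym (inj A V c (inj B (fun A V) (fun A c) (trans eq (sym (trans (cong (fun B) fun-c) (fun-axis r)))))))
        (seg-end origin c))

      module D = Drag r 0<r

      drawing₃-outside : ∀ p → OnDrawing d₃ p → D.OutsideOrTip p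
      drawing₃-outside p p∈ = go (kite? (- 1ℚ) r p)
        where
        go : Dec (Kite (- 1ℚ) r p) → D.OutsideOrTip p
        go (yes in-kite) = inj₁ (drawing₃∩kite p p∈ in-kite)
        go (no ∉kite)    = inj₂ ∉kite

      private
        traces : Traces D.drag D.OutsideOrTip
        traces a b out = D.traces-drag a b λ p p∈ → D.tip-outside p (out p p∈)

      d₄ : PlaneDrawing H
      d₄ = transferred d₃ D.drag D.OutsideOrTip drawing₃-outside D.drag-injective traces

      at-u₄ : pos d₄ u ≡ rc
      at-u₄ = trans (cong D.drag at-u₃) D.drag-tip

      at-v₄ : pos d₄ v ≡ pos d₃ v
      at-v₄ = D.drag-far (pos d₃ v) λ in-kite → V₃≢rc (rest₃∩kite _ (path-end rc cs₃ (pos d₃ v)) in-kite)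

      -- A point of the new drawing either has not moved, and the old curve was free there, or lies
      -- in the wide kite, which the rest of the curve meets only at (r, 0), the new place of u.
      free₄ : ∀ p → OnDrawing d₄ p → OnPath rc cs₃ (pos d₃ v) p → p ≡ rc ⊎ p ≡ pos d₃ v
      free₄ p p∈ p∈rest =
        let q , q∈ , p≡ = on-transferred d₃ D.drag D.OutsideOrTip drawing₃-outside D.drag-injective traces p p∈ in
        [ (λ fixed → ⊎-map
            (λ p≡tip → rest₃∩kite p p∈rest (subst (Kite (- 2ℚ) r) (sym p≡tip)
              (axis-kite (- 2ℚ) r {tip} refl (<⇒≤ -2<-1) (<⇒≤ (<-trans (negative⁻¹ (- 1ℚ)) 0<r))))) id
            (free₃ p (subst (OnDrawing d₃) (sym (trans p≡ fixed)) q∈) p∈rest))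
        , (λ in-kite → inj₁ (rest₃∩kite p p∈rest (subst (Kite (- 2ℚ) r) (sym p≡) in-kite)))
        ]′ (D.drag-local q (D.tip-outside q (drawing₃-outside q q∈)))
        where
        -2<-1 : - 2ℚ < - 1ℚ
        -2<-1 = <-by 0<1 refl

      contradiction : ⊥
      contradiction = ¬shorter (d₄ , cs₃ ,
        (λ p p∈ p∈path → subst₂ (λ U V → p ≡ U ⊎ p ≡ V) (sym at-u₄) (sym at-v₄)
          (free₄ p p∈ (subst₂ (λ U V → OnPath U cs₃ V p) at-u₄ at-v₄ p∈path))) ,
        subst (ℕ._≤ n) (sym (trans (length-map (fun B) cs₂) (length-map (fun A) cs))) cs≤n)

    shorten : ∀ n → JoinedBy (ℕ.suc n) → ¬ ¬ JoinedBy n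
    shorten n (d , [] , free , _) ¬shorter = ¬shorter (d , [] , free , z≤n)
    shorten n (d , c ∷ cs , free , s≤s cs≤n) ¬shorter with pos d u ≟ₚ c
    ... | yes U≡c = ¬shorter (d , cs , (λ p p∈D p∈path →
            free p p∈D (inj₂ (subst (λ a → OnPath a cs (pos d v) p) U≡c p∈path))) , cs≤n)
    ... | no U≢c = DragStep.contradiction n ¬shorter (moved A d) (map (fun A) cs)
            (subst (ℕ._≤ n) (sym (length-map (fun A) cs)) cs≤n)
            (toAxis-start (pos d u) c U≢c 0ℚ 1ℚ (<⇒≢ 0<1))
            (subst (λ a → FreePath (moved A d) (a ∷ map (fun A) cs)) (toAxis-end (pos d u) c U≢c 0ℚ 1ℚ (<⇒≢ 0<1))
              (free-moved A d (c ∷ cs) free))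
      where
      A = toAxis (pos d u) c U≢c 0ℚ 1ℚ (<⇒≢ 0<1)

    straight : ∀ n → JoinedBy n → ¬ ¬ JoinedBy 0
    straight ℕ.zero    j k = k j
    straight (ℕ.suc n) j k = shorten n j λ j′ → straight n j′ k

    record BallComplement : Set where
      field
        drawing : PlaneDrawing H
        at-u    : pos drawing u ≡ (- 1ℚ , 0ℚ)
        at-v    : pos drawing v ≡ (1ℚ , 0ℚ)
        outside : ∀ p → OnDrawing drawing p → p ≡ (- 1ℚ , 0ℚ) ⊎ p ≡ (1ℚ , 0ℚ) ⊎ 1ℚ < ‖ p ‖

    module Thicken (d₀ : PlaneDrawing H) (free : FreePath d₀ []) where
      private
        U≢V : pos d₀ u ≢ pos d₀ v
        U≢V = u≢v ∘ pos-inj d₀ u v u∈ v∈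
        A = toAxis (pos d₀ u) (pos d₀ v) U≢V (- 1ℚ) 1ℚ (<⇒≢ -1<1)
        d₁ = moved A d₀
        at-u₁ = toAxis-start (pos d₀ u) (pos d₀ v) U≢V (- 1ℚ) 1ℚ (<⇒≢ -1<1)
        at-v₁ = toAxis-end (pos d₀ u) (pos d₀ v) U≢V (- 1ℚ) 1ℚ (<⇒≢ -1<1)

        axis : ∀ p → OnDrawing d₁ p → proj₂ p ≡ 0ℚ → - 1ℚ ≤ proj₁ p → proj₁ p ≤ 1ℚ → p ≡ (- 1ℚ , 0ℚ) ⊎ p ≡ (1ℚ , 0ℚ)
        axis p p∈ y≡0 lo hi = subst₂ (λ U V → p ≡ U ⊎ p ≡ V) at-u₁ at-v₁ (free-moved A d₀ [] free p p∈
          (subst₂ (λ U V → OnSeg U V p) (sym at-u₁) (sym at-v₁) (seg-axis (- 1ℚ) 1ℚ p -1<1 y≡0 lo hi)))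

        thin = tame-drawing (tame-thin (- 1ℚ) 1ℚ (negative⁻¹ (- 1ℚ)) 0<1) d₁
          λ p p∈ y≡0 → either-side (- 1ℚ) 1ℚ (proj₁ p) λ (lo , hi) →
            [ (λ eq → <-irrefl (sym (cong proj₁ eq)) lo) , (λ eq → <-irrefl (cong proj₁ eq) hi) ]′ (axis p p∈ y≡0 (<⇒≤ lo) (<⇒≤ hi))

        K = proj₁ thin ⊔ 1ℚ
        B = stretchʸ K (<-≤-trans 0<1 (p≤q⊔p (proj₁ thin) 1ℚ))

        fun-axis : ∀ x → fun B (x , 0ℚ) ≡ (x , 0ℚ)
        fun-axis x = cong (x ,_) (*-zeroʳ K)

        outside : ∀ p → OnDrawing (moved B d₁) p → p ≡ (- 1ℚ , 0ℚ) ⊎ p ≡ (1ℚ , 0ℚ) ⊎ 1ℚ < ‖ p ‖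
        outside p p∈ = go (‖ p ‖ ≤? 1ℚ)
          where
          go : Dec (‖ p ‖ ≤ 1ℚ) → p ≡ (- 1ℚ , 0ℚ) ⊎ p ≡ (1ℚ , 0ℚ) ⊎ 1ℚ < ‖ p ‖
          go (no ≰1) = inj₂ (inj₂ (≰⇒> ≰1))
          go (yes ≤1) =
            let q , q∈ , p≡ = on-moved B d₁ p p∈
                in-kite = subst (Kite (- 1ℚ) 1ℚ) p≡ (ball-kite p ≤1)
                y≡0 = proj₂ thin K (p≤p⊔q (proj₁ thin) 1ℚ) q q∈ in-kite
                lo , hi = kite-axis (- 1ℚ) 1ℚ {fun B q} (trans (cong (K *_) y≡0) (*-zeroʳ K)) in-kite
            in [ (λ eq → inj₁ (trans p≡ (trans (cong (fun B) eq) (fun-axis (- 1ℚ)))))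
               , (λ eq → inj₂ (inj₁ (trans p≡ (trans (cong (fun B) eq) (fun-axis 1ℚ)))))
               ]′ (axis q q∈ y≡0 lo hi)

      ballComplement : BallComplement
      ballComplement = record
        { drawing = moved B d₁
        ; at-u    = trans (cong (fun B) at-u₁) (fun-axis (- 1ℚ))
        ; at-v    = trans (cong (fun B) at-v₁) (fun-axis 1ℚ)
        ; outside = outside
        }

    clear-ball : ∀ d cs → FreePath d cs → ¬ ¬ BallComplement
    clear-ball d cs free k = straight (length cs) (d , cs , free , ℕₚ.≤-refl) λ where
      (d₀ , [] , free₀ , _) → k (Thicken.ballComplement d₀ free₀)

  -- Deleting and restoring an edge

  ∧-true : ∀ {a b} → a ∧ b ≡ true → a ≡ true × b ≡ true
  ∧-true {true} {true} _ = refl , refl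

  ∨-trueˡ : ∀ {a b} → a ≡ true → a ∨ b ≡ true
  ∨-trueˡ refl = refl

  ∨-trueʳ : ∀ {a b} → b ≡ true → a ∨ b ≡ true
  ∨-trueʳ {a} refl = ∨-zeroʳ a

  does-true : ∀ {P : Set} (P? : Dec P) → does P? ≡ true → P
  does-true (yes p) _ = p

  bool-ext : ∀ {a b} → (a ≡ true → b ≡ true) → (b ≡ true → a ≡ true) → a ≡ b
  bool-ext {true}  {b}     f g = sym (f refl)
  bool-ext {false} {true}  f g = g refl
  bool-ext {false} {false} f g = refl

  sameEdge? : ∀ (u v x y : Fin N) → Dec (SameEdge u v x y)
  sameEdge? u v x y = ((u Fin.≟ x) ×-dec (v Fin.≟ y)) ⊎-dec ((u Fin.≟ y) ×-dec (v Fin.≟ x))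

  isEdge : (u v x y : Fin N) → Bool
  isEdge u v x y = does (sameEdge? u v x y)

  isEdge-sym : ∀ (u v x y : Fin N) → isEdge u v x y ≡ isEdge u v y x
  isEdge-sym u v x y = ∨-comm (does ((u Fin.≟ x) ×-dec (v Fin.≟ y))) _

  _─_↔_ : Graph N → Fin N → Fin N → Graph N
  H ─ u ↔ v = record
    { VS     = VS H
    ; Adj    = λ x y → Adj H x y ∧ not (isEdge u v x y)
    ; sym    = λ x y → cong₂ (λ a b → a ∧ not b) (Adj-sym H x y) (isEdge-sym u v x y)
    ; irrefl = λ x → cong (_∧ not (isEdge u v x x)) (irrefl H x)
    ; adj-vs = λ x y xy → adj-vs H x y (proj₁ (∧-true xy))
    }

  edgeGraph : (u v : Fin N) → u ≢ v → Graph N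
  edgeGraph u v u≢v = record
    { VS     = λ w → does (w Fin.≟ u) ∨ does (w Fin.≟ v)
    ; Adj    = isEdge u v
    ; sym    = isEdge-sym u v
    ; irrefl = λ x → dec-false (sameEdge? u v x x) λ { (inj₁ (refl , refl)) → u≢v refl ; (inj₂ (refl , refl)) → u≢v refl }
    ; adj-vs = λ x y xy → [ (λ { (refl , _) → ∨-trueˡ (dec-true (u Fin.≟ u) refl) })
                          , (λ { (_ , refl) → ∨-trueʳ (dec-true (v Fin.≟ v) refl) }) ]′ (does-true (sameEdge? u v x y) xy)
    }

  module _ (H : Graph N) (u v : Fin N) where

    deleted-distinct : ∀ {x y} → Adj (H ─ u ↔ v) x y ≡ true → ¬ SameEdge u v x y
    deleted-distinct {x} {y} xy same with ∧-true {Adj H x y} xy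
    ... | _ , ≢ rewrite dec-true (sameEdge? u v x y) same with ≢
    ... | ()

    restore-edge : (u≢v : u ≢ v) → Adj H u v ≡ true → IsUnion H (H ─ u ↔ v) (edgeGraph u v u≢v)
    restore-edge u≢v uv =
      (λ x → bool-ext ∨-trueˡ λ h → [ id , (λ x∈ → [ (λ h → subst (λ x → VS H x ≡ true) (sym (does-true (x Fin.≟ u) h)) (adj-vs H u v uv))
                                                  , (λ h → subst (λ x → VS H x ≡ true) (sym (does-true (x Fin.≟ v) h)) (Adj-vsʳ H u v uv)) ]′
                                                  (∨-true x∈)) ]′ (∨-true {VS H x} h)) ,
      (λ x y → bool-ext (split x y) λ h → [ proj₁ ∘ ∧-true , same x y ∘ does-true (sameEdge? u v x y) ]′ (∨-true {Adj H x y ∧ _} h))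
      where
      same : ∀ x y → SameEdge u v x y → Adj H x y ≡ true
      same x y (inj₁ (refl , refl)) = uv
      same x y (inj₂ (refl , refl)) = trans (Adj-sym H v u) uv
      split : ∀ x y → Adj H x y ≡ true → (Adj H x y ∧ not (isEdge u v x y)) ∨ isEdge u v x y ≡ true
      split x y xy with isEdge u v x y
      ... | true  = ∨-zeroʳ _
      ... | false = trans (∨-identityʳ _) (trans (∧-identityʳ _) xy)

  -- Edge-amalgamation of planar graphs

  module EdgeDrawing (u v : Fin N) (u≢v : u ≢ v) where

    private
      l r top : Point
      l = - 1ℚ , 0ℚ
      r = 1ℚ , 0ℚ
      top = 0ℚ , 1ℚ

      place : Fin N → Point
      place w with w Fin.≟ u
      ... | yes _ = l
      ... | no _  = r

      vertex : ∀ w → VS (edgeGraph u v u≢v) w ≡ true → w ≡ u ⊎ w ≡ v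
      vertex w w∈ = ⊎-map (does-true (w Fin.≟ u)) (does-true (w Fin.≟ v)) (∨-true {does (w Fin.≟ u)} w∈)

    place-u : place u ≡ l
    place-u with u Fin.≟ u
    ... | yes _  = refl
    ... | no u≢u = ⊥-elim (u≢u refl)

    place-v : place v ≡ r
    place-v with v Fin.≟ u
    ... | yes v≡u = ⊥-elim (u≢v (sym v≡u))
    ... | no _    = refl

    private
      l≢r : l ≢ r
      l≢r ()

      edge-ends : ∀ {a b w : Fin N} → SameEdge u v a b → w ≡ u ⊎ w ≡ v → w ≡ a ⊎ w ≡ b
      edge-ends (inj₁ (refl , refl)) = id
      edge-ends (inj₂ (refl , refl)) = swap

      two-edges : ∀ {a b x y : Fin N} → SameEdge u v a b → SameEdge u v x y → SameEdge a b x y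
      two-edges (inj₁ (refl , refl)) s = s
      two-edges (inj₂ (refl , refl)) (inj₁ (refl , refl)) = inj₂ (refl , refl)
      two-edges (inj₂ (refl , refl)) (inj₂ (refl , refl)) = inj₁ (refl , refl)

    edgeDrawing : PlaneDrawing (edgeGraph u v u≢v)
    pos     edgeDrawing = place
    -- Bending at (0, 1) in both orientations, e runs along the upper boundary of the ball. Having
    -- norm 1 throughout, it can touch the drawing outside and the one inside only at (∓1, 0).
    bends   edgeDrawing x y = top ∷ []
    pos-inj edgeDrawing x y x∈ y∈ eq = go (vertex x x∈) (vertex y y∈)
      where
      go : x ≡ u ⊎ x ≡ v → y ≡ u ⊎ y ≡ v → x ≡ y
      go (inj₁ refl) (inj₁ refl) = refl
      go (inj₂ refl) (inj₂ refl) = refl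
      go (inj₁ refl) (inj₂ refl) = ⊥-elim (l≢r (trans (sym place-u) (trans eq place-v)))
      go (inj₂ refl) (inj₁ refl) = ⊥-elim (l≢r (trans (sym place-u) (trans (sym eq) place-v)))
    avoid   edgeDrawing a b w ab w∈ _ = edge-ends (does-true (sameEdge? u v a b) ab) (vertex w w∈)
    cross   edgeDrawing a b x y p ab xy distinct _ _ =
      ⊥-elim (distinct (two-edges (does-true (sameEdge? u v a b) ab) (does-true (sameEdge? u v x y) xy)))

    private
      unit-norm : ∀ {x y} t → 0ℚ ≤ t → t ≤ 1ℚ → ∣ x ∣ ≡ 1ℚ - t → y ≡ t → ‖ x , y ‖ ≡ 1ℚ
      unit-norm t 0≤t t≤1 eqx refl = trans (cong₂ _+_ eqx (0≤p⇒∣p∣≡p 0≤t)) (lem t)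
        where
        lem : ∀ t → 1ℚ - t + t ≡ 1ℚ
        lem = solve-∀ ℚ-ring

      left : ∀ {p} → OnSeg l top p → ‖ p ‖ ≡ 1ℚ
      left (t , 0≤t , t≤1 , refl) = unit-norm t 0≤t t≤1
        (trans (p≤0⇒∣p∣≡-p (≤-by (0≤-from-≤ t≤1) (lem₁ t))) (lem₂ t)) (lem₃ t)
        where
        lem₁ : ∀ t → 0ℚ - (- 1ℚ + t * (0ℚ - - 1ℚ)) ≡ 1ℚ - t
        lem₁ = solve-∀ ℚ-ring
        lem₂ : ∀ t → - (- 1ℚ + t * (0ℚ - - 1ℚ)) ≡ 1ℚ - t
        lem₂ = solve-∀ ℚ-ring
        lem₃ : ∀ t → 0ℚ + t * (1ℚ - 0ℚ) ≡ t
        lem₃ = solve-∀ ℚ-ring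

      right : ∀ {p} → OnSeg r top p → ‖ p ‖ ≡ 1ℚ
      right (t , 0≤t , t≤1 , refl) = unit-norm t 0≤t t≤1
        (trans (0≤p⇒∣p∣≡p (≤-by (0≤-from-≤ t≤1) (lem₁ t))) (lem₂ t)) (lem₃ t)
        where
        lem₁ : ∀ t → 1ℚ + t * (0ℚ - 1ℚ) - 0ℚ ≡ 1ℚ - t
        lem₁ = solve-∀ ℚ-ring
        lem₂ : ∀ t → 1ℚ + t * (0ℚ - 1ℚ) ≡ 1ℚ - t
        lem₂ = solve-∀ ℚ-ring
        lem₃ : ∀ t → 0ℚ + t * (1ℚ - 0ℚ) ≡ t
        lem₃ = solve-∀ ℚ-ring

      spoke : ∀ w {p} → w ≡ u ⊎ w ≡ v → OnSeg (place w) top p → ‖ p ‖ ≡ 1ℚ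
      spoke w {p} (inj₁ refl) p∈ = left (subst (λ a → OnSeg a top p) place-u p∈)
      spoke w {p} (inj₂ refl) p∈ = right (subst (λ a → OnSeg a top p) place-v p∈)

      ends : ∀ {x y} → SameEdge u v x y → (x ≡ u ⊎ x ≡ v) × (y ≡ u ⊎ y ≡ v)
      ends (inj₁ (refl , refl)) = inj₁ refl , inj₂ refl
      ends (inj₂ (refl , refl)) = inj₂ refl , inj₁ refl

    on-edgeDrawing : ∀ p → OnDrawing edgeDrawing p → ‖ p ‖ ≡ 1ℚ
    on-edgeDrawing p (inj₁ (w , w∈ , refl)) = spoke w (vertex w w∈) (seg-start (place w) top)
    on-edgeDrawing p (inj₂ (x , y , xy , p∈)) =
      [ spoke x (proj₁ (ends same)) , spoke y (proj₂ (ends same)) ∘ seg-rev top (place y) ]′ p∈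
      where
      same = does-true (sameEdge? u v x y) xy

  module Amalgam {A B M : Graph N} (u v : Fin N) (union : IsUnion M A B) (uv∈A : Adj A u v ≡ true) (uv∈B : Adj B u v ≡ true)
    (shared : ∀ w → VS A w ≡ true → VS B w ≡ true → w ≡ u ⊎ w ≡ v) where

    private
      u≢v : u ≢ v
      u≢v refl = true≢false uv∈A (irrefl A u)

      module SA = Straighten (A ─ u ↔ v) u v (adj-vs A u v uv∈A) (Adj-vsʳ A u v uv∈A) u≢v
      module SB = Straighten (B ─ u ↔ v) u v (adj-vs B u v uv∈B) (Adj-vsʳ B u v uv∈B) u≢v

      l r : Point
      l = - 1ℚ , 0ℚ
      r = 1ℚ , 0ℚ

    module Glue (bcA : SA.BallComplement) (bcB : SB.BallComplement) where
      private
        module CA = SA.BallComplement bcA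
        module CB = SB.BallComplement bcB
        module E = EdgeDrawing u v u≢v

        ends-agree : ∀ {f g : Fin N → Point} → f u ≡ l → f v ≡ r → g u ≡ l → g v ≡ r → ∀ w → w ≡ u ⊎ w ≡ v → f w ≡ g w
        ends-agree fu fv gu gv w (inj₁ refl) = trans fu (sym gu)
        ends-agree fu fv gu gv w (inj₂ refl) = trans fv (sym gv)

        restore = restore-edge A u v u≢v uv∈A

        agree₁ : ∀ w → VS A w ≡ true → VS (edgeGraph u v u≢v) w ≡ true → pos CA.drawing w ≡ pos E.edgeDrawing w
        agree₁ w _ w∈ = ends-agree CA.at-u CA.at-v E.place-u E.place-v w
          (⊎-map (does-true (w Fin.≟ u)) (does-true (w Fin.≟ v)) (∨-true {does (w Fin.≟ u)} w∈))

        meet₁ : ∀ p → OnDrawing CA.drawing p → OnDrawing E.edgeDrawing p →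
                ∃ λ w → VS A w ≡ true × VS (edgeGraph u v u≢v) w ≡ true × p ≡ pos CA.drawing w
        meet₁ p p∈A p∈E = go (CA.outside p p∈A)
          where
          go : p ≡ l ⊎ p ≡ r ⊎ 1ℚ < ‖ p ‖ → _
          go (inj₁ eq) = u , adj-vs A u v uv∈A , ∨-trueˡ (dec-true (u Fin.≟ u) refl) , trans eq (sym CA.at-u)
          go (inj₂ (inj₁ eq)) = v , Adj-vsʳ A u v uv∈A , ∨-trueʳ (dec-true (v Fin.≟ v) refl) , trans eq (sym CA.at-v)
          go (inj₂ (inj₂ 1<)) = ⊥-elim (<-absurd 1< (≤-reflexive (E.on-edgeDrawing p p∈E)))

        dA : PlaneDrawing A
        dA = union-drawing restore CA.drawing E.edgeDrawing agree₁ meet₁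

        dA-u : pos dA u ≡ l
        dA-u = trans (pos∪₁ {G = A} restore CA.drawing E.edgeDrawing agree₁ meet₁ u (adj-vs A u v uv∈A)) CA.at-u
        dA-v : pos dA v ≡ r
        dA-v = trans (pos∪₁ {G = A} restore CA.drawing E.edgeDrawing agree₁ meet₁ v (Adj-vsʳ A u v uv∈A)) CA.at-v

        dA-outside : ∀ p → OnDrawing dA p → 1ℚ ≤ ‖ p ‖
        dA-outside p p∈ = [ (λ p∈A → go (CA.outside p p∈A)) , (λ p∈E → ≤-reflexive (sym (E.on-edgeDrawing p p∈E))) ]′
          (on-union {G = A} restore CA.drawing E.edgeDrawing agree₁ meet₁ p p∈)
          where
          go : p ≡ l ⊎ p ≡ r ⊎ 1ℚ < ‖ p ‖ → 1ℚ ≤ ‖ p ‖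
          go (inj₁ refl) = ≤-refl
          go (inj₂ (inj₁ refl)) = ≤-refl
          go (inj₂ (inj₂ 1<)) = <⇒≤ 1<

        CB-outside : ∀ p → OnDrawing CB.drawing p → 1ℚ ≤ ‖ p ‖
        CB-outside p p∈ = go (CB.outside p p∈)
          where
          go : p ≡ l ⊎ p ≡ r ⊎ 1ℚ < ‖ p ‖ → 1ℚ ≤ ‖ p ‖
          go (inj₁ refl) = ≤-refl
          go (inj₂ (inj₁ refl)) = ≤-refl
          go (inj₂ (inj₂ 1<)) = <⇒≤ 1<

        fixed-l : invertBall l ≡ l
        fixed-l = refl
        fixed-r : invertBall r ≡ r
        fixed-r = refl

        dB : PlaneDrawing (B ─ u ↔ v)
        dB = transferred CB.drawing invertBall (λ p → 1ℚ ≤ ‖ p ‖) CB-outside invertBall-injective traces-invertBall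

        dB-u : pos dB u ≡ l
        dB-u = trans (cong invertBall CB.at-u) fixed-l
        dB-v : pos dB v ≡ r
        dB-v = trans (cong invertBall CB.at-v) fixed-r

        dB-inside : ∀ p → OnDrawing dB p → p ≡ l ⊎ p ≡ r ⊎ ‖ p ‖ < 1ℚ
        dB-inside p p∈ =
          let q , q∈ , p≡ = on-transferred CB.drawing invertBall (λ p → 1ℚ ≤ ‖ p ‖) CB-outside invertBall-injective traces-invertBall p p∈
          in ⊎-map (λ q≡ → trans p≡ (trans (cong invertBall q≡) fixed-l))
               (⊎-map (λ q≡ → trans p≡ (trans (cong invertBall q≡) fixed-r))
                  (λ 1< → subst (λ p → ‖ p ‖ < 1ℚ) (sym p≡) (invertBall-inside q 1<))) (CB.outside q q∈)

        -- `A` already contributes e, so `B` can enter without its copy.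
        union′ : IsUnion M A (B ─ u ↔ v)
        union′ = proj₁ union , λ x y → trans (proj₂ union x y) (bool-ext
          (λ h → [ ∨-trueˡ , keep x y ]′ (∨-true {Adj A x y} h))
          (λ h → [ ∨-trueˡ , ∨-trueʳ {Adj A x y} ∘ proj₁ ∘ ∧-true {Adj B x y} ]′ (∨-true {Adj A x y} h)))
          where
          keep : ∀ x y → Adj B x y ≡ true → Adj A x y ∨ (Adj B x y ∧ not (isEdge u v x y)) ≡ true
          keep x y xy = go (sameEdge? u v x y)
            where
            go : Dec (SameEdge u v x y) → Adj A x y ∨ (Adj B x y ∧ not (isEdge u v x y)) ≡ true
            go (yes (inj₁ (refl , refl))) = ∨-trueˡ uv∈A
            go (yes (inj₂ (refl , refl))) = ∨-trueˡ (trans (Adj-sym A v u) uv∈A)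
            go (no ¬same) = ∨-trueʳ {Adj A x y} (cong₂ (λ a b → a ∧ not b) xy (dec-false (sameEdge? u v x y) ¬same))

        agree₂ : ∀ w → VS A w ≡ true → VS B w ≡ true → pos dA w ≡ pos dB w
        agree₂ w w∈A w∈B = ends-agree dA-u dA-v dB-u dB-v w (shared w w∈A w∈B)

        -- The norm separates the two drawings: at least 1 on `dA`, and less than 1 on `dB` except
        -- at the images of u and v.
        meet₂ : ∀ p → OnDrawing dA p → OnDrawing dB p → ∃ λ w → VS A w ≡ true × VS B w ≡ true × p ≡ pos dA w
        meet₂ p p∈A p∈B = go (dB-inside p p∈B)
          where
          go : p ≡ l ⊎ p ≡ r ⊎ ‖ p ‖ < 1ℚ → ∃ λ w → VS A w ≡ true × VS B w ≡ true × p ≡ pos dA w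
          go (inj₁ eq) = u , adj-vs A u v uv∈A , adj-vs B u v uv∈B , trans eq (sym dA-u)
          go (inj₂ (inj₁ eq)) = v , Adj-vsʳ A u v uv∈A , Adj-vsʳ B u v uv∈B , trans eq (sym dA-v)
          go (inj₂ (inj₂ <1)) = ⊥-elim (<-absurd <1 (dA-outside p p∈A))

      glued : PlaneDrawing M
      glued = union-drawing union′ dA dB agree₂ meet₂

    delete : ∀ {H : Graph N} → PlaneDrawing H → PlaneDrawing (H ─ u ↔ v)
    delete = subgraph-drawing (λ _ → id) (λ x y → proj₁ ∘ ∧-true)

    -- For vertices this is `avoid`, for the other edges `cross`, which applies because deletion
    -- leaves only edges distinct from e. Deletion keeps all positions, so the curve still ends at u
    -- and v.
    free-edge : ∀ {H : Graph N} (d : PlaneDrawing H) → Adj H u v ≡ true → ∀ p → OnDrawing (delete d) p →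
                EdgePath d u v p → p ≡ pos d u ⊎ p ≡ pos d v
    free-edge d uv p (inj₁ (w , w∈ , refl)) p∈uv = ⊎-map (cong (pos d)) (cong (pos d)) (avoid d u v w uv w∈ p∈uv)
    free-edge {H} d uv p (inj₂ (x , y , xy , p∈xy)) p∈uv =
      let w , w∈uv , _ , p≡ = cross d u v x y p uv (proj₁ (∧-true xy)) (deleted-distinct H u v xy) p∈uv p∈xy
      in ⊎-map (λ w≡u → trans p≡ (cong (pos d) w≡u)) (λ w≡v → trans p≡ (cong (pos d) w≡v)) w∈uv

    amalgam-planar : Planar A → Planar B → ¬ ¬ Planar M
    amalgam-planar dA dB k =
      SA.clear-ball (delete dA) (bends dA u v) (free-edge dA uv∈A) λ bcA →
      SB.clear-ball (delete dB) (bends dB u v) (free-edge dB uv∈B) λ bcB →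
      k (Glue.glued bcA bcB)

  -- Isolated vertices

  fromℕ : ℕ → ℚ
  fromℕ ℕ.zero    = 0ℚ
  fromℕ (ℕ.suc n) = 1ℚ + fromℕ n

  0≤fromℕ : ∀ n → 0ℚ ≤ fromℕ n
  0≤fromℕ ℕ.zero    = ≤-refl
  0≤fromℕ (ℕ.suc n) = 0≤+ 0≤1 (0≤fromℕ n)

  fromℕ-injective : ∀ m n → fromℕ m ≡ fromℕ n → m ≡ n
  fromℕ-injective ℕ.zero    ℕ.zero    eq = refl
  fromℕ-injective ℕ.zero    (ℕ.suc n) eq = ⊥-elim (<⇒≢ (0<+≤ 0<1 (0≤fromℕ n)) eq)
  fromℕ-injective (ℕ.suc m) ℕ.zero    eq = ⊥-elim (<⇒≢ (0<+≤ 0<1 (0≤fromℕ m)) (sym eq))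
  fromℕ-injective (ℕ.suc m) (ℕ.suc n) eq = cong ℕ.suc (fromℕ-injective m n
    (≡-by (trans (lem (fromℕ m) (fromℕ n)) (drop-eq 0ℚ (- 1ℚ) eq))))
    where
    lem : ∀ m n → n - m ≡ 0ℚ + - 1ℚ * (1ℚ + m - (1ℚ + n))
    lem = solve-∀ ℚ-ring

  module AddIsolated {A M : Graph N} (V⊆ : ∀ x → VS A x ≡ true → VS M x ≡ true) (E≡ : ∀ x y → Adj M x y ≡ Adj A x y)
    (d : PlaneDrawing A) where

    private
      rest : Graph N
      rest = record
        { VS     = λ x → VS M x ∧ not (VS A x)
        ; Adj    = λ _ _ → false
        ; sym    = λ _ _ → refl
        ; irrefl = λ _ → refl
        ; adj-vs = λ _ _ ()
        }

      bounded = tame-drawing tame-bounded d (λ _ _ → tt)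
      K = proj₁ bounded

      place : Fin N → Point
      -- `K` bounds the first coordinates of the drawing. The extra 1 makes the separation strict,
      -- and the index keeps the new vertices apart.
      place w = K + (1ℚ + fromℕ (toℕ w)) , 0ℚ

      restDrawing : PlaneDrawing rest
      restDrawing = record
        { pos     = place
        ; bends   = λ _ _ → []
        ; pos-inj = λ x y _ _ eq → Fin.toℕ-injective (fromℕ-injective _ _
            (≡-by (trans (lem K (fromℕ (toℕ x)) (fromℕ (toℕ y))) (drop-eq 0ℚ (- 1ℚ) (cong proj₁ eq)))))
        ; avoid   = λ _ _ _ ()
        ; cross   = λ _ _ _ _ _ ()
        }
        where
        lem : ∀ K m n → n - m ≡ 0ℚ + - 1ℚ * (K + (1ℚ + m) - (K + (1ℚ + n)))
        lem = solve-∀ ℚ-ring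

      union : IsUnion M A rest
      union = (λ x → cover (VS A x) (VS M x) (V⊆ x)) , λ x y → trans (E≡ x y) (sym (∨-identityʳ _))
        where
        cover : ∀ a m → (a ≡ true → m ≡ true) → m ≡ a ∨ (m ∧ not a)
        cover true  m h = h refl
        cover false m h = sym (∧-identityʳ m)

      far : ∀ p → OnDrawing d p → ¬ OnDrawing restDrawing p
      far p p∈ (inj₁ (w , _ , refl)) = <-absurd
        (<-by (0<+≤ 0<1 (0≤fromℕ (toℕ w))) (lem K (1ℚ + fromℕ (toℕ w))))
        (proj₂ bounded K ≤-refl p p∈)
        where
        lem : ∀ K z → K + z - K ≡ z
        lem = solve-∀ ℚ-ring
      far p p∈ (inj₂ (_ , _ , () , _))

    withIsolated : PlaneDrawing M
    withIsolated = union-drawing union d restDrawing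
      (λ w w∈A w∈rest → ⊥-elim (disjoint (VS A w) (VS M w) w∈A w∈rest))
      (λ p p∈ p∈rest → ⊥-elim (far p p∈ p∈rest))
      where
      disjoint : ∀ a m → a ≡ true → m ∧ not a ≡ true → ⊥
      disjoint true true refl ()

  open AddIsolated public using (withIsolated)

open import Data.Nat using (ℕ; zero; suc; _≤_; _+_; _∸_; _⊔_)
open import Data.Nat.Properties using (_≤?_; ⊔-lub)
open import Relation.Nullary.Decidable using (decidable-stable)
open Geometry using (subgraph-drawing; ∧-true; ∨-true; ∨-trueˡ; ∨-trueʳ; withIsolated; module Amalgam)

open PlanarDecomposition
open Equivalence using (to; from)

private variable
  N : ℕ

-- Decompositions

part⊆ : ∀ {G : Graph N} {k} (D : PlanarDecomposition G k) i {x y} → Adj (part D i) x y ≡ true → Adj G x y ≡ true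
part⊆ D i {x} {y} xy = from (covers D x y) (i , xy)

restrict : ∀ {G G′ : Graph N} {k} → (∀ x → VS G′ x ≡ true → VS G x ≡ true) →
           (∀ x y → Adj G′ x y ≡ true → Adj G x y ≡ true) →
           PlanarDecomposition G k → PlanarDecomposition G′ k
restrict {G = G} {G′} V⊆ E⊆ D = record
  { part     = λ i → record
      { VS     = VS G′
      ; Adj    = λ x y → Adj (part D i) x y ∧ Adj G′ x y
      ; sym    = λ x y → cong₂ _∧_ (Adj-sym (part D i) x y) (Adj-sym G′ x y)
      ; irrefl = λ x → cong (_∧ Adj G′ x x) (irrefl (part D i) x)
      ; adj-vs = λ x y xy → adj-vs G′ x y (proj₂ (∧-true {Adj (part D i) x y} xy))
      }
  ; spanning = λ _ _ → refl
  ; planar   = λ i → subgraph-drawing (λ x x∈ → trans (spanning D i x) (V⊆ x x∈)) (λ x y → proj₁ ∘ ∧-true) (planar D i)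
  ; disjoint = λ i j x y xyᵢ xyⱼ → disjoint D i j x y (proj₁ (∧-true xyᵢ)) (proj₁ (∧-true xyⱼ))
  ; covers   = λ x y → mk⇔
      (λ xy → let i , xyᵢ = to (covers D x y) (E⊆ x y xy) in i , cong₂ _∧_ xyᵢ xy)
      (λ (i , xyᵢ) → proj₂ (∧-true {Adj (part D i) x y} xyᵢ))
  }

spanBy : (G H : Graph N) → (∀ x → VS H x ≡ true → VS G x ≡ true) → Graph N
spanBy G H V⊆ = record
  { VS     = VS G
  ; Adj    = Adj H
  ; sym    = Adj-sym H
  ; irrefl = irrefl H
  ; adj-vs = λ x y xy → V⊆ x (adj-vs H x y xy)
  }

joinIn : (G A B : Graph N) → (∀ x → VS A x ≡ true → VS G x ≡ true) → (∀ x → VS B x ≡ true → VS G x ≡ true) → Graph N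
joinIn G A B A⊆ B⊆ = record
  { VS     = VS G
  ; Adj    = λ x y → Adj A x y ∨ Adj B x y
  ; sym    = λ x y → cong₂ _∨_ (Adj-sym A x y) (Adj-sym B x y)
  ; irrefl = λ x → cong₂ _∨_ (irrefl A x) (irrefl B x)
  ; adj-vs = λ x y xy → [ A⊆ x ∘ adj-vs A x y , B⊆ x ∘ adj-vs B x y ]′ (∨-true xy)
  }

shared-edge : ∀ {G₁ G₂ : Graph N} {u v} → IntersectionIsEdge G₁ G₂ u v → Adj G₁ u v ≡ true × Adj G₂ u v ≡ true
shared-edge {u = u} {v} inter = ∧-true (from (proj₂ inter u v) (inj₁ (refl , refl)))

-- Assembling the decomposition of the amalgamation

module Amalgamation {G G₁ G₂ : Graph N} (u v : Fin N) (union : IsUnion G G₁ G₂) (inter : IntersectionIsEdge G₁ G₂ u v)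
  {m₁ m₂ : ℕ} (D₁ : PlanarDecomposition G₁ (suc m₁)) (D₂ : PlanarDecomposition G₂ (suc m₂)) where

  private
    uv∈    = shared-edge {G₁ = G₁} {G₂} inter
    found₁ = to (covers D₁ u v) (proj₁ uv∈)
    found₂ = to (covers D₂ u v) (proj₂ uv∈)
    i₀ = proj₁ found₁
    j₀ = proj₁ found₂
    A  = part D₁
    B  = part D₂

    A⊆ : ∀ i x → VS (A i) x ≡ true → VS G x ≡ true
    A⊆ i x x∈ = trans (proj₁ union x) (∨-trueˡ (trans (sym (spanning D₁ i x)) x∈))

    B⊆ : ∀ j x → VS (B j) x ≡ true → VS G x ≡ true
    B⊆ j x x∈ = trans (proj₁ union x) (∨-trueʳ {VS G₁ x} (trans (sym (spanning D₂ j x)) x∈))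

    merged : Graph N
    merged = joinIn G (A i₀) (B j₀) (A⊆ i₀) (B⊆ j₀)

  merged-planar : ¬ ¬ Planar merged
  merged-planar = Amalgam.amalgam-planar {A = A i₀} {B j₀} {merged} u v
    ((λ x → trans (proj₁ union x) (sym (cong₂ _∨_ (spanning D₁ i₀ x) (spanning D₂ j₀ x)))) , λ _ _ → refl)
    (proj₂ found₁) (proj₂ found₂)
    (λ w w∈A w∈B → to (proj₁ inter w) (cong₂ _∧_ (trans (sym (spanning D₁ i₀ w)) w∈A) (trans (sym (spanning D₂ j₀ w)) w∈B)))
    (planar D₁ i₀) (planar D₂ j₀)

  private
    -- The part `i₀` has no index of its own: it shares that of `j₀`, where the merged graph sits.
    -- This accounts for the -1 in the upper bound.
    Index = Fin m₁ ⊎ Fin (suc m₂)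

    piece : Index → Graph N
    piece (inj₁ i) = spanBy G (A (punchIn i₀ i)) (A⊆ _)
    piece (inj₂ j) with j Fin.≟ j₀
    ... | yes _ = merged
    ... | no _  = spanBy G (B j) (B⊆ j)

    piece-spanning : ∀ s x → VS (piece s) x ≡ VS G x
    piece-spanning (inj₁ i) x = refl
    piece-spanning (inj₂ j) x with j Fin.≟ j₀
    ... | yes _ = refl
    ... | no _  = refl

    piece-planar : Planar merged → ∀ s → Planar (piece s)
    piece-planar _ (inj₁ i) = withIsolated (A⊆ (punchIn i₀ i)) (λ _ _ → refl) (planar D₁ (punchIn i₀ i))
    piece-planar merged-planar (inj₂ j) with j Fin.≟ j₀
    ... | yes _ = merged-planar
    ... | no _  = withIsolated (B⊆ j) (λ _ _ → refl) (planar D₂ j)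

    slot : Fin (suc m₁) → Index
    slot i with i₀ Fin.≟ i
    ... | yes _   = inj₂ j₀
    ... | no i₀≢i = inj₁ (punchOut i₀≢i)

    slot-i₀ : slot i₀ ≡ inj₂ j₀
    slot-i₀ with i₀ Fin.≟ i₀
    ... | yes _   = refl
    ... | no ≢    = ⊥-elim (≢ refl)

    slot-punchIn : ∀ i → slot (punchIn i₀ i) ≡ inj₁ i
    slot-punchIn i with i₀ Fin.≟ punchIn i₀ i
    ... | yes eq = ⊥-elim (Fin.punchInᵢ≢i i₀ i (sym eq))
    ... | no ≢   = cong inj₁ (trans (Fin.punchOut-cong i₀ refl) (Fin.punchOut-punchIn i₀))

    -- Records which given part an edge of a piece came from, so that disjointness becomes a matter
    -- of four cases instead of the case distinctions inside `piece`.
    data Origin (s : Index) (x y : Fin N) : Set where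
      from-A : ∀ i → Adj (A i) x y ≡ true → s ≡ slot i → Origin s x y
      from-B : ∀ j → Adj (B j) x y ≡ true → s ≡ inj₂ j → Origin s x y

    origin : ∀ s {x y} → Adj (piece s) x y ≡ true → Origin s x y
    origin (inj₁ i) xy = from-A (punchIn i₀ i) xy (sym (slot-punchIn i))
    origin (inj₂ j) xy with j Fin.≟ j₀
    ... | no _     = from-B j xy refl
    ... | yes refl = [ (λ xyA → from-A i₀ xyA (sym slot-i₀)) , (λ xyB → from-B j₀ xyB refl) ]′ (∨-true xy)

    A-in-piece : ∀ i {x y} → Adj (A i) x y ≡ true → Adj (piece (slot i)) x y ≡ true
    A-in-piece i {x} {y} xy with i₀ Fin.≟ i
    ... | no i₀≢i = subst (λ i → Adj (A i) x y ≡ true) (sym (Fin.punchIn-punchOut i₀≢i)) xy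
    ... | yes refl with j₀ Fin.≟ j₀
    ...   | yes _ = ∨-trueˡ xy
    ...   | no ≢  = ⊥-elim (≢ refl)

    B-in-piece : ∀ j {x y} → Adj (B j) x y ≡ true → Adj (piece (inj₂ j)) x y ≡ true
    B-in-piece j {x} {y} xy with j Fin.≟ j₀
    ... | yes refl = ∨-trueʳ {Adj (A i₀) x y} xy
    ... | no _     = xy

    -- The only edge in both G₁ and G₂ is e, so by disjointness i = `i₀` and j = `j₀`, and these two
    -- share a slot.
    common-edge : ∀ i j {x y} → Adj (A i) x y ≡ true → Adj (B j) x y ≡ true → slot i ≡ inj₂ j
    common-edge i j {x} {y} xyA xyB = at (to (proj₂ inter x y) (cong₂ _∧_ (part⊆ D₁ i xyA) (part⊆ D₂ j xyB)))
      where
      at-uv : Adj (A i) u v ≡ true → Adj (B j) u v ≡ true → slot i ≡ inj₂ j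
      at-uv uvA uvB = trans (cong slot (disjoint D₁ i i₀ u v uvA (proj₂ found₁)))
        (trans slot-i₀ (cong inj₂ (disjoint D₂ j₀ j u v (proj₂ found₂) uvB)))
      at : (x ≡ u × y ≡ v) ⊎ (x ≡ v × y ≡ u) → slot i ≡ inj₂ j
      at (inj₁ (refl , refl)) = at-uv xyA xyB
      at (inj₂ (refl , refl)) = at-uv (trans (Adj-sym (A i) u v) xyA) (trans (Adj-sym (B j) u v) xyB)

    piece-disjoint : ∀ s s′ x y → Adj (piece s) x y ≡ true → Adj (piece s′) x y ≡ true → s ≡ s′
    piece-disjoint s s′ x y xy xy′ = go (origin s xy) (origin s′ xy′)
      where
      go : Origin s x y → Origin s′ x y → s ≡ s′
      go (from-A i xyᵢ refl) (from-A i′ xyᵢ′ refl) = cong slot (disjoint D₁ i i′ x y xyᵢ xyᵢ′)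
      go (from-B j xyⱼ refl) (from-B j′ xyⱼ′ refl) = cong inj₂ (disjoint D₂ j j′ x y xyⱼ xyⱼ′)
      go (from-A i xyᵢ refl) (from-B j xyⱼ refl) = common-edge i j xyᵢ xyⱼ
      go (from-B j xyⱼ refl) (from-A i xyᵢ refl) = sym (common-edge i j xyᵢ xyⱼ)

    piece-covers : ∀ x y → Adj G x y ≡ true → ∃ λ s → Adj (piece s) x y ≡ true
    piece-covers x y xy =
      [ (λ xy₁ → let i , xyᵢ = to (covers D₁ x y) xy₁ in slot i , A-in-piece i xyᵢ)
      , (λ xy₂ → let j , xyⱼ = to (covers D₂ x y) xy₂ in inj₂ j , B-in-piece j xyⱼ)
      ]′ (∨-true (trans (sym (proj₂ union x y)) xy))

    piece⊆ : ∀ s x y → Adj (piece s) x y ≡ true → Adj G x y ≡ true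
    piece⊆ s x y xy = trans (proj₂ union x y) (go (origin s xy))
      where
      go : Origin s x y → Adj G₁ x y ∨ Adj G₂ x y ≡ true
      go (from-A i xyᵢ _) = ∨-trueˡ (part⊆ D₁ i xyᵢ)
      go (from-B j xyⱼ _) = ∨-trueʳ {Adj G₁ x y} (part⊆ D₂ j xyⱼ)

  amalgamated : Planar merged → PlanarDecomposition G (m₁ + suc m₂)
  amalgamated merged-planar = record
    { part     = piece ∘ splitAt m₁
    ; spanning = piece-spanning ∘ splitAt m₁
    ; planar   = piece-planar merged-planar ∘ splitAt m₁
    ; disjoint = λ k k′ x y xy xy′ → trans (sym (Fin.join-splitAt m₁ (suc m₂) k))
        (trans (cong (join m₁ (suc m₂)) (piece-disjoint (splitAt m₁ k) (splitAt m₁ k′) x y xy xy′)) (Fin.join-splitAt m₁ (suc m₂) k′))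
    ; covers   = λ x y → mk⇔
        (λ xy → let s , xyₛ = piece-covers x y xy in
          join m₁ (suc m₂) s , subst (λ s → Adj (piece s) x y ≡ true) (sym (Fin.splitAt-join m₁ (suc m₂) s)) xyₛ)
        (λ (k , xyₖ) → piece⊆ (splitAt m₁ k) x y xyₖ)
    }

theorem2p3 : ∀ {N : ℕ} (G G₁ G₂ : Graph N) (u v : Fin N) (n₁ n₂ t : ℕ) →
    IsUnion G G₁ G₂ →
    Adj G u v ≡ true →
    IntersectionIsEdge G₁ G₂ u v →
    IsThickness G₁ n₁ → IsThickness G₂ n₂ → IsThickness G t →
    (n₁ ⊔ n₂ ≤ t) × (t ≤ n₁ + n₂ ∸ 1)
theorem2p3 G G₁ G₂ u v n₁ n₂ t union _ inter (D₁ , min₁) (D₂ , min₂) (D , min) =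
  ⊔-lub (min₁ t (restrict (λ x x∈ → trans (proj₁ union x) (∨-trueˡ x∈))
                          (λ x y xy → trans (proj₂ union x y) (∨-trueˡ xy)) D))
        (min₂ t (restrict (λ x x∈ → trans (proj₁ union x) (∨-trueʳ {VS G₁ x} x∈))
                          (λ x y xy → trans (proj₂ union x y) (∨-trueʳ {Adj G₁ x y} xy)) D)) ,
  upper n₁ n₂ D₁ D₂
  where
  uv∈ = shared-edge {G₁ = G₁} {G₂} inter

  upper : ∀ n₁ n₂ → PlanarDecomposition G₁ n₁ → PlanarDecomposition G₂ n₂ → t ≤ n₁ + n₂ ∸ 1
  -- Some part contains e, so neither decomposition is empty. With both numbers successors, n₁ + n₂
  -- ∸ 1 computes to `m₁ + suc m₂` without truncation.
  upper zero _ D₁ _ with to (covers D₁ u v) (proj₁ uv∈)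
  ... | () , _
  upper (suc _) zero _ D₂ with to (covers D₂ u v) (proj₂ uv∈)
  ... | () , _
  upper (suc m₁) (suc m₂) D₁ D₂ = decidable-stable (t ≤? m₁ + suc m₂) λ t≰ →
    Am.merged-planar λ planar → t≰ (min (m₁ + suc m₂) (Am.amalgamated planar))
    where
    module Am = Amalgamation {G = G} u v union inter D₁ D₂
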